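{- For all $L\in\mathbf N$, $$G\left(L,L+1,\tfrac{13}{4},2,4,q\right)\geq0.$$
   Context: $\mathbf N$ denotes the set of nonnegative integers. For $m\in\mathbf N$, $(q)_m=\prod_{j=1}^m(1-q^j)$, with $(q)_0=1$. The $q$-binomial coefficient is $\begin{bmatrix} m+n\\ m\end{bmatrix}_q=\frac{(q)_{m+n}}{(q)_m(q)_n}$ if $m,n\in\mathbf N$, and it is $0$ otherwise (so $\begin{bmatrix} A\\ B\end{bmatrix}_q=0$ unless $0\le B\le A$). Define $$G(N,M,\alpha,\beta,K,q)=\sum_{j=-\infty}^\infty(-1)^j q^{Kj\frac{(\alpha+\beta)j+(\alpha-\beta)}{2}}\begin{bmatrix} N+M\\ N-Kj\end{bmatrix}_q .$$ The notation $P(q)\ge 0$ means that $P(q)$ is a polynomial in $q$ with nonnegative coefficients. -}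

module Defs where

open import Data.Nat.Base as ℕ using (ℕ; zero; suc; NonZero)
import Data.Nat.Properties as ℕ
open import Data.Integer.Base as ℤ
  using (ℤ; +_; -[1+_]; 0ℤ; 1ℤ; -1ℤ; ∣_∣; +<+)
import Data.Integer.Properties as ℤ
open import Data.Rational.Base as ℚ using (ℚ; mkℚ; 0ℚ; ½)
open import Data.List.Base using (List; []; _∷_)
open import Data.Bool.Base using (if_then_else_)
open import Data.Product.Base using (∃)
open import Relation.Binary.PropositionalEquality
  using (_≡_; refl; sym; trans; cong; cong₂; module ≡-Reasoning)

-- Formal power series over ℤ, given by their coefficients

Series : Set
Series = ℕ → ℤ

tail : Series → Series
tail f n = f (suc n)

infixl 6 _⊖_
infixl 7 _⊗_ _⊘_ _⊙_

_⊖_ : Series → Series → Series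
(f ⊖ g) n = f n ℤ.- g n

_⊙_ : ℤ → Series → Series
(c ⊙ f) n = c ℤ.* f n

-- With f = f₀ + q f′:  f g = f₀ g + q (f′ g).
_⊗_ : Series → Series → Series
(f ⊗ g) zero    = f 0 ℤ.* g 0
(f ⊗ g) (suc n) = f 0 ℤ.* g (suc n) ℤ.+ (tail f ⊗ g) n

-- Long division in ascending powers of q.  This is the quotient f / g only
-- when g has constant term 1; see ⊘-correct.
_⊘_ : Series → Series → Series
(f ⊘ g) zero    = f 0
(f ⊘ g) (suc n) = ((tail f ⊖ f 0 ⊙ tail g) ⊘ g) n

⊘-correct : ∀ f g → g 0 ≡ 1ℤ → ∀ n → ((f ⊘ g) ⊗ g) n ≡ f n
⊘-correct f g g₀ zero    = trans (cong (f 0 ℤ.*_) g₀) (ℤ.*-identityʳ (f 0))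
⊘-correct f g g₀ (suc n) = begin
  x ℤ.+ (((tail f ⊖ f 0 ⊙ tail g) ⊘ g) ⊗ g) n
    ≡⟨ cong (λ y → x ℤ.+ y) (⊘-correct (tail f ⊖ f 0 ⊙ tail g) g g₀ n) ⟩
  x ℤ.+ (f (suc n) ℤ.- x)
    ≡⟨ ℤ.+-comm x _ ⟩
  f (suc n) ℤ.- x ℤ.+ x
    ≡⟨ ℤ.+-assoc (f (suc n)) (ℤ.- x) x ⟩
  f (suc n) ℤ.+ (ℤ.- x ℤ.+ x)
    ≡⟨ cong (λ y → f (suc n) ℤ.+ y) (ℤ.+-inverseˡ x) ⟩
  f (suc n) ℤ.+ 0ℤ
    ≡⟨ ℤ.+-identityʳ _ ⟩
  f (suc n) ∎
  where
  open ≡-Reasoning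
  x = f 0 ℤ.* g (suc n)

infix 8 q^_

q^_ : ℕ → Series
(q^ j) n = if n ℕ.≡ᵇ j then 1ℤ else 0ℤ

⟨q⟩_ : ℕ → Series
⟨q⟩ zero  = q^ 0
⟨q⟩ suc m = (⟨q⟩ m) ⊗ (q^ 0 ⊖ q^ suc m)

⟨q⟩-const : ∀ m → (⟨q⟩ m) 0 ≡ 1ℤ
⟨q⟩-const zero    = refl
⟨q⟩-const (suc m) = cong (ℤ._* 1ℤ) (⟨q⟩-const m)

-- The top entry is m + n and the bottom entry is m.
qBinomial : ℤ → ℤ → Series
qBinomial A B with B | A ℤ.- B
... | + m | + n = ⟨q⟩ (m ℕ.+ n) ⊘ ((⟨q⟩ m) ⊗ (⟨q⟩ n))
... | _   | _   = λ _ → 0ℤ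

qBinomial-quotient : ∀ m n k →
  (qBinomial (+ (m ℕ.+ n)) (+ m) ⊗ ((⟨q⟩ m) ⊗ (⟨q⟩ n))) k ≡ (⟨q⟩ (m ℕ.+ n)) k
qBinomial-quotient m n k
  rewrite trans (ℤ.m-n≡m⊖n (m ℕ.+ n) m)
         (trans (ℤ.⊖-≥ (ℕ.m≤m+n m n)) (cong +_ (ℕ.m+n∸m≡n m n)))
  = ⊘-correct (⟨q⟩ (m ℕ.+ n)) ((⟨q⟩ m) ⊗ (⟨q⟩ n))
      (cong₂ ℤ._*_ (⟨q⟩-const m) (⟨q⟩-const n)) k

-- Formal expressions Σ c_e q^e with rational exponents, e ↦ c_e.  Rational
-- exponents are needed because α and β are rational.

QSeries : Set
QSeries = ℚ → ℤ

-- q^ r · f: its coefficient at e is that of f at e - r when e - r ∈ ℕ, and 0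
-- otherwise.
shift : ℚ → Series → QSeries
shift r f e with e ℚ.- r
... | mkℚ (+ n) 0 _ = f n
... | _             = 0ℤ

-- Σ± b f = Σ_{j = -b}^{b} f j
Σ± : ℕ → (ℤ → ℤ) → ℤ
Σ± zero    f = f 0ℤ
Σ± (suc b) f = Σ± b f ℤ.+ (f (+ suc b) ℤ.+ f -[1+ b ])

fromℤ : ℤ → ℚ
fromℤ i = i ℚ./ 1

exponent : (α β : ℚ) (K : ℕ) (j : ℤ) → ℚ
exponent α β K j =
  fromℤ (+ K ℤ.* j) ℚ.* (((α ℚ.+ β) ℚ.* fromℤ j ℚ.+ (α ℚ.- β)) ℚ.* ½)

-- The sum over all j ∈ ℤ is finite: terms with ∣ j ∣ > N + M vanish by
-- G-support, so the sum is cut off there.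
G : (N M : ℕ) (α β : ℚ) (K : ℕ) .{{_ : NonZero K}} → QSeries
G N M α β K e = Σ± (N ℕ.+ M) λ j →
  (-1ℤ ℤ.^ ∣ j ∣) ℤ.*
  shift (exponent α β K j) (qBinomial (+ N ℤ.+ + M) (+ N ℤ.- + K ℤ.* j)) e

qBinomial-neg : ∀ A B → B ℤ.< 0ℤ → ∀ n → qBinomial A B n ≡ 0ℤ
qBinomial-neg A -[1+ _ ] _        n = refl
qBinomial-neg A (+ _)    (+<+ ()) n

qBinomial-big : ∀ A B → A ℤ.- B ℤ.< 0ℤ → ∀ n → qBinomial A B n ≡ 0ℤ
qBinomial-big A B A-B<0 n with B | A ℤ.- B
... | + _      | -[1+ _ ] = refl
... | -[1+ _ ] | _        = refl
qBinomial-big A B (+<+ ()) n | + _ | + _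

G-support : ∀ N M K .{{_ : NonZero K}} j → N ℕ.+ M ℕ.< ∣ j ∣ →
            ∀ n → qBinomial (+ N ℤ.+ + M) (+ N ℤ.- + K ℤ.* j) n ≡ 0ℤ
G-support N M K (+ j) N+M<j = qBinomial-neg (+ N ℤ.+ + M) (+ N ℤ.- + K ℤ.* + j) (begin-strict
  + N ℤ.- + K ℤ.* + j    ≡⟨ cong (λ x → + N ℤ.- x) (ℤ.pos-* K j) ⟨
  + N ℤ.- + (K ℕ.* j)    <⟨ ℤ.+-monoˡ-< (ℤ.- + (K ℕ.* j)) (+<+ N<Kj) ⟩
  + (K ℕ.* j) ℤ.- + (K ℕ.* j) ≡⟨ ℤ.+-inverseʳ (+ (K ℕ.* j)) ⟩
  0ℤ                     ∎)
  where
  open ℤ.≤-Reasoning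
  N<Kj : N ℕ.< K ℕ.* j
  N<Kj = ℕ.<-≤-trans (ℕ.≤-<-trans (ℕ.m≤m+n N M) N+M<j) (ℕ.m≤n*m j K)
G-support N M K -[1+ j ] N+M<j = qBinomial-big (+ N ℤ.+ + M) (+ N ℤ.- + K ℤ.* -[1+ j ]) (begin-strict
  + (N ℕ.+ M) ℤ.- (+ N ℤ.- + K ℤ.* -[1+ j ])
    ≡⟨ cong (λ x → + (N ℕ.+ M) ℤ.- (+ N ℤ.+ x)) neg ⟩
  + (N ℕ.+ M) ℤ.- + (N ℕ.+ k)
    <⟨ ℤ.+-monoˡ-< (ℤ.- + (N ℕ.+ k)) (+<+ N+M<N+k) ⟩
  + (N ℕ.+ k) ℤ.- + (N ℕ.+ k)
    ≡⟨ ℤ.+-inverseʳ (+ (N ℕ.+ k)) ⟩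
  0ℤ ∎)
  where
  open ℤ.≤-Reasoning
  k = K ℕ.* suc j
  neg : ℤ.- (+ K ℤ.* -[1+ j ]) ≡ + k
  neg = trans (ℤ.neg-distribʳ-* (+ K) -[1+ j ]) (sym (ℤ.pos-* K (suc j)))
  N+M<N+k : N ℕ.+ M ℕ.< N ℕ.+ k
  N+M<N+k = ℕ.<-≤-trans N+M<j
    (ℕ.≤-trans (ℕ.m≤n*m (suc j) K) (ℕ.m≤n+m k N))

polynomial : List ℕ → Series
polynomial []       _       = 0ℤ
polynomial (c ∷ cs) zero    = + c
polynomial (c ∷ cs) (suc n) = polynomial cs n

infix 4 _≥0

_≥0 : QSeries → Set
P ≥0 = ∃ λ (cs : List ℕ) → ∀ e → P e ≡ shift 0ℚ (polynomial cs) e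

{-# OPTIONS --safe #-}

-- With T(j) = j(j+1)/2 the exponent of the j-th term is j(5j+1)/2 + T(4j).  Let
-- P_L(j) = q^{T(j)} [2L+1; L-j].  Then P_L = (1 + q^{2L} + q^L X) P_{L-1} with
-- X = σ + σ⁻¹, where σ shifts j, while for H_k(j) = [k; ⌊(k-j)/2⌋] one has
-- X H_k = H_{k+1} + (1 - q^k) H_{k-1}.  Solving the recurrence in this basis gives the
-- positivity-preserving transformation
--   P_L(j) = Σ_s q^{T(s)} [L; s] Σ_m q^{T(m)} [s; m] H_{s-m}(j).
-- Summing over 4j against (-1)^j q^{j(5j+1)/2} replaces H_k by
--   Σ_j (-1)^j q^{j(5j+1)/2} [k; ⌊k/2⌋ - 2j],
-- and this is Bressoud's finite Rogers–Ramanujan sum Σ_m q^{m²} [⌊k/2⌋; m] ≥ 0.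

module Submission where

open import Defs
import Data.Integer.Base as ℤ
import Data.Integer.Properties as ℤ
open import Data.List.Base using (List; []; _∷_; _++_; map)
open import Data.Nat.Base as ℕ using (zero; suc; ⌊_/2⌋)
open import Data.Nat.Coprimality as Coprimality using (1-coprimeTo)
import Data.Nat.Properties as ℕ
open import Data.Product.Base using (∃; _×_; _,_; proj₁; proj₂; map₁; map₂)
open import Data.Rational.Base as ℚ using (ℚ; mkℚ; ½; 0ℚ; toℚᵘ)
import Data.Rational.Properties as ℚ
import Data.Rational.Solver
open import Data.Rational.Unnormalised.Base as ℚᵘ using (mkℚᵘ; *≡*)
import Data.Rational.Unnormalised.Properties as ℚᵘ
open import Data.Sum.Base using (_⊎_; inj₁; inj₂)
open import Function.Base using (_∘_)
open import Relation.Binary.PropositionalEquality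
  using (_≡_; _≢_; refl; sym; trans; cong; cong₂; subst; module ≡-Reasoning)
open import Relation.Nullary.Negation.Core using (contradiction)

-- The obstacle is the sign in the factor 1 - q^k: iterating the recurrence for P_L directly in the
-- basis H_k produces negative terms. The combinations w_s = Σ_m q^{T(m)} [s; m] H_{s-m} obey X w_s
-- = w_{s+1} - q^{s+1} w_s + (1 - q^s) w_{s-1}. Summed over s with the weights q^{T(s)} [L; s], the
-- last two terms together contribute exactly -q^{L+1} times the weighted sum of the w_s. This
-- cancels the q^{2L+2} in the passage from P_L to P_{L+1}, and only positive terms survive. All
-- bilateral sums run over one window -b ≤ i ≤ b, fixed in advance and common to every k, so that
-- they commute with the finite functionals in k and s. The price is paid in the Rogers-Ramanujan
-- part: i ↦ -1 - i does not preserve the window, so the terms at its ends must be shown to vanish.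
-- This is the source of the bounds n < b and k < b.

module Positivity where

  open import Algebra.Properties.CommutativeSemigroup ℤ.+-commutativeSemigroup using (interchange)
  open import Data.Integer.Base
    using (ℤ; +_; -[1+_]; 0ℤ; 1ℤ; -1ℤ; ∣_∣; _+_; _-_; _*_; -_; _^_)
  open import Data.Integer.Tactic.RingSolver using (solve-∀)
  open import Data.Nat.Base using (ℕ)

  -- Gaussian binomials

  minus-comm : ∀ e a b → e - a - b ≡ e - b - a
  minus-comm = solve-∀

  -- A Laurent series in q is its coefficient function, so that q^a · f is
  -- λ e → f (e - a).
  Laurent : Set
  Laurent = ℤ → ℤ

  δ : ℤ → Laurent
  δ (+ 0) (+ 0) = 1ℤ
  δ _     _     = 0ℤ

  -- Generated by a Pascal rule instead of a quotient, with an integer lower entry, so that shifts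
  -- and reflections of that entry need no side conditions. Agreement with the quotient is
  -- `ι-qBinomial`.
  gauss : ℕ → ℤ → Laurent
  gauss zero    j e = δ j e
  gauss (suc k) j e = gauss k j e + gauss k (j - 1ℤ) (e - (+ suc k - j))

  -- The companion of the defining rule. The two rules, applied one after the other in either order,
  -- lead to the same four terms, which gives the induction step.
  pascal : ∀ k j e → gauss (suc k) j e ≡ gauss k (j - 1ℤ) e + gauss k j (e - j)
  pascal zero (+ 0) e =
    trans (ℤ.+-comm (δ 0ℤ e) 0ℤ) (cong (λ x → 0ℤ + δ 0ℤ x) (sym (ℤ.+-identityʳ e)))
  pascal zero (+ 1) e =
    trans (ℤ.+-comm 0ℤ (δ 0ℤ (e - 0ℤ))) (cong (λ x → δ 0ℤ x + 0ℤ) (ℤ.+-identityʳ e))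
  pascal zero (+ suc (suc n)) e = refl
  pascal zero -[1+ n ] e = refl
  pascal (suc k) j e = begin
    gauss (suc k) j e + gauss (suc k) (j - 1ℤ) e′
      ≡⟨ cong₂ _+_ (pascal k j e) (pascal k (j - 1ℤ) e′) ⟩
    (g₁ e + g₀ (e - j)) + (g₂ e′ + g₁ (e′ - (j - 1ℤ)))
      ≡⟨ interchange (g₁ e) (g₀ (e - j)) (g₂ e′) _ ⟩
    (g₁ e + g₂ e′) + (g₀ (e - j) + g₁ (e′ - (j - 1ℤ)))
      ≡⟨ cong₂ (λ x y → (g₁ e + g₂ x) + (g₀ (e - j) + g₁ y)) (x₁ e (+ k) j) (x₂ e (+ k) j) ⟩
    gauss (suc k) (j - 1ℤ) e + gauss (suc k) j (e - j) ∎
    where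
    open ≡-Reasoning
    e′ = e - (+ suc (suc k) - j)
    g₀ = gauss k j
    g₁ = gauss k (j - 1ℤ)
    g₂ = gauss k (j - 1ℤ - 1ℤ)
    x₁ : ∀ e k j → e - (1ℤ + (1ℤ + k) - j) ≡ e - (1ℤ + k - (j - 1ℤ))
    x₁ = solve-∀
    x₂ : ∀ e k j → e - (1ℤ + (1ℤ + k) - j) - (j - 1ℤ) ≡ e - j - (1ℤ + k - j)
    x₂ = solve-∀

  gauss-sym : ∀ k j e → gauss k (+ k - j) e ≡ gauss k j e
  gauss-sym zero (+ 0) e = refl
  gauss-sym zero (+ suc n) e = refl
  gauss-sym zero -[1+ n ] e = refl
  gauss-sym (suc k) j e = trans (pascal k (+ suc k - j) e) (cong₂ _+_
    (trans (cong (λ i → gauss k i e) (x₁ (+ k) j)) (gauss-sym k j e))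
    (trans (cong (λ i → gauss k i (e - (+ suc k - j))) (x₂ (+ k) j))
           (gauss-sym k (j - 1ℤ) (e - (+ suc k - j)))))
    where
    x₁ : ∀ k j → 1ℤ + k - j - 1ℤ ≡ k - j
    x₁ = solve-∀
    x₂ : ∀ k j → 1ℤ + k - j ≡ k - (j - 1ℤ)
    x₂ = solve-∀

  gauss-neg : ∀ k n e → gauss k -[1+ n ] e ≡ 0ℤ
  gauss-neg zero    n e = refl
  gauss-neg (suc k) n e = cong₂ _+_ (gauss-neg k n e) (gauss-neg k (suc (n ℕ.+ 0)) _)

  gauss-big : ∀ k n e → gauss k (+ k + + suc n) e ≡ 0ℤ
  gauss-big k n e = begin
    gauss k (+ k + + suc n) e          ≡⟨ gauss-sym k _ e ⟨
    gauss k (+ k - (+ k + + suc n)) e  ≡⟨ cong (λ i → gauss k i e) (x (+ k) (+ suc n)) ⟩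
    gauss k -[1+ n ] e                 ≡⟨ gauss-neg k n e ⟩
    0ℤ                                 ∎
    where
    open ≡-Reasoning
    x : ∀ k n → k - (k + n) ≡ - n
    x = solve-∀

  gauss-0 : ∀ k e → gauss k 0ℤ e ≡ δ 0ℤ e
  gauss-0 zero    e = refl
  gauss-0 (suc k) e = trans (cong₂ _+_ (gauss-0 k e) (gauss-neg k 0 _)) (ℤ.+-identityʳ _)

  gauss-full : ∀ k e → gauss k (+ k) e ≡ δ 0ℤ e
  gauss-full k e = trans (cong (λ i → gauss k i e) (sym (ℤ.+-identityʳ (+ k))))
                         (trans (gauss-sym k 0ℤ e) (gauss-0 k e))

  gauss-neg-exp : ∀ k j n → gauss k j -[1+ n ] ≡ 0ℤ
  gauss-neg-exp zero    (+ 0) n = refl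
  gauss-neg-exp zero    (+ suc _) n = refl
  gauss-neg-exp zero    -[1+ _ ] n = refl
  gauss-neg-exp (suc k) j n = cong₂ _+_ (gauss-neg-exp k j n) (second (+ suc k - j) refl)
    where
    x : ∀ k j → j - 1ℤ ≡ k + - (1ℤ + k - j)
    x = solve-∀
    second : ∀ d → + suc k - j ≡ d → gauss k (j - 1ℤ) (-[1+ n ] - (+ suc k - j)) ≡ 0ℤ
    second (+ 0)     d≡ rewrite d≡ = gauss-neg-exp k (j - 1ℤ) n
    second (+ suc d) d≡ rewrite d≡ = gauss-neg-exp k (j - 1ℤ) (suc (n ℕ.+ d))
    -- The shift by k + 1 - j is negative here and could raise the exponent to a nonnegative one,
    -- but then j - 1 exceeds k and the binomial itself is zero.
    second -[1+ d ]  d≡ = trans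
      (cong (λ i → gauss k i (-[1+ n ] - (+ suc k - j))) (trans (x (+ k) j) (cong (λ i → + k - i) d≡)))
      (gauss-big k d _)

  -- Continuous q-Hermite polynomials and their three-term recurrence

  Δ : (ℕ → Laurent) → (ℕ → Laurent)
  Δ f zero    e = 0ℤ
  Δ f (suc k) e = f k e - f k (e - + suc k)

  -- Rounds down at negative arguments too (-1 goes to -1); truncation towards 0 would break
  -- `half-+2`.
  half : ℤ → ℤ
  half (+ n)    = + ⌊ n /2⌋
  half -[1+ n ] = -[1+ ⌊ n /2⌋ ]

  half-+2 : ∀ z → half (z + + 2) ≡ half z + 1ℤ
  half-+2 z = trans (cong half (ℤ.+-comm z (+ 2))) (trans (h z) (ℤ.+-comm 1ℤ (half z)))
    where
    h : ∀ z → half (+ 2 + z) ≡ 1ℤ + half z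
    h (+ n) = refl
    h -[1+ 0 ] = refl
    h -[1+ 1 ] = refl
    h -[1+ suc (suc n) ] = refl

  ⌊1+n+n/2⌋ : ∀ n → ⌊ suc (n ℕ.+ n) /2⌋ ≡ n
  ⌊1+n+n/2⌋ zero = refl
  ⌊1+n+n/2⌋ (suc n) rewrite ℕ.+-suc n n = cong suc (⌊1+n+n/2⌋ n)

  half-double : ∀ m → half (m + m) ≡ m
  half-double (+ n)    = cong +_ (sym (ℕ.n≡⌊n+n/2⌋ n))
  half-double -[1+ n ] = cong -[1+_] (⌊1+n+n/2⌋ n)

  half-1+double : ∀ m → half (1ℤ + (m + m)) ≡ m
  half-1+double (+ n)    = cong +_ (⌊1+n+n/2⌋ n)
  half-1+double -[1+ n ] = cong -[1+_] (sym (ℕ.n≡⌊n+n/2⌋ n))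

  -- As Laurent polynomials Σ_j H k j σ^j these are continuous q-Hermite polynomials;
  -- H-X is their three-term recurrence under multiplication by σ + σ⁻¹.
  H : ℕ → ℤ → Laurent
  H k j = gauss k (half (+ k - j))

  gauss-X₀ : ∀ m e → gauss 0 m e + gauss 0 (m - 1ℤ) e ≡ gauss 1 m e + 0ℤ
  gauss-X₀ m e = trans (ℤ.+-comm (δ m e) _) (sym (trans (ℤ.+-identityʳ _)
    (trans (pascal 0 m e) (cong (λ x → δ (m - 1ℤ) e + x) (δ-shift m)))))
    where
    δ-shift : ∀ m → δ m (e - m) ≡ δ m e
    δ-shift (+ 0)     = cong (δ 0ℤ) (ℤ.+-identityʳ e)
    δ-shift (+ suc _) = refl
    δ-shift -[1+ _ ]  = refl

  -- Expand [k+1; m] by one Pascal rule, add and subtract q^{k+1} [k; m-1], and refold with both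
  -- rules.
  gauss-X : ∀ k m e → gauss (suc k) m e + gauss (suc k) (m - 1ℤ) e ≡
    gauss (suc (suc k)) m e + (gauss k (m - 1ℤ) e - gauss k (m - 1ℤ) (e - + suc k))
  gauss-X k m e = begin
    gauss (suc k) m e + g₁
      ≡⟨ cong (_+ g₁) (pascal k m e) ⟩
    (gauss k (m - 1ℤ) e + gauss k m (e - m)) + g₁
      ≡⟨ arrange (gauss k (m - 1ℤ) e) (gauss k m (e - m)) (gauss k (m - 1ℤ) (e - + suc k)) g₁ ⟩
    (g₁ + (gauss k m (e - m) + gauss k (m - 1ℤ) (e - + suc k))) + d
      ≡⟨ cong (λ x → (g₁ + (gauss k m (e - m) + gauss k (m - 1ℤ) x)) + d) (x (+ k) m e) ⟩
    (g₁ + gauss (suc k) m (e - m)) + d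
      ≡⟨ cong (_+ d) (pascal (suc k) m e) ⟨
    gauss (suc (suc k)) m e + d ∎
    where
    open ≡-Reasoning
    g₁ = gauss (suc k) (m - 1ℤ) e
    d = gauss k (m - 1ℤ) e - gauss k (m - 1ℤ) (e - + suc k)
    arrange : ∀ a b c d → (a + b) + d ≡ (d + (b + c)) + (a - c)
    arrange = solve-∀
    x : ∀ k m e → e - (1ℤ + k) ≡ e - m - (1ℤ + k - m)
    x = solve-∀

  -- The numbers k - (j - 1) and k - (j + 1) differ by 2, so for either parity their halves are
  -- consecutive lower entries m and m - 1.
  H-X : ∀ k j e → H k (j - 1ℤ) e + H k (j + 1ℤ) e ≡ H (suc k) j e + Δ (λ k → H k j) k e
  H-X k j e = trans
    (cong₂ (λ x y → gauss k x e + gauss k y e) (cong half (x₁ (+ k) j))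
      (trans (half-back (+ k - (j + 1ℤ))) (cong (λ i → half i - 1ℤ) (x₂ (+ k) j))))
    (cases k)
    where
    x₁ : ∀ k j → k - (j - 1ℤ) ≡ 1ℤ + k - j
    x₁ = solve-∀
    x₂ : ∀ k j → k - (j + 1ℤ) + + 2 ≡ 1ℤ + k - j
    x₂ = solve-∀
    x₃ : ∀ a → a ≡ a + 1ℤ - 1ℤ
    x₃ = solve-∀
    x₄ : ∀ k j → k - j + + 2 ≡ 1ℤ + (1ℤ + k) - j
    x₄ = solve-∀
    half-back : ∀ z → half z ≡ half (z + + 2) - 1ℤ
    half-back z = trans (x₃ (half z)) (cong (_- 1ℤ) (sym (half-+2 z)))
    cases : ∀ k → let m = half (+ suc k - j) in
      gauss k m e + gauss k (m - 1ℤ) e ≡ H (suc k) j e + Δ (λ k → H k j) k e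
    cases zero    = gauss-X₀ (half (+ 1 - j)) e
    cases (suc k) = trans (gauss-X k (half (+ suc (suc k) - j)) e)
      (cong (λ i → H (suc (suc k)) j e + (gauss k i e - gauss k i (e - + suc k)))
        (sym (trans (half-back (+ k - j)) (cong (λ i → half i - 1ℤ) (x₄ (+ k) j)))))

  -- Functionals with nonnegative coefficients

  -- A list of pairs (k , a) stands for the functional f ↦ Σ q^a f k.  Such functionals
  -- manifestly preserve nonnegativity.
  ⟦_⟧ : List (ℕ × ℕ) → (ℕ → Laurent) → Laurent
  ⟦ [] ⟧          f e = 0ℤ
  ⟦ (k , a) ∷ l ⟧ f e = f k (e - + a) + ⟦ l ⟧ f e

  ⟦⟧-cong : ∀ l {f g} → (∀ k e → f k e ≡ g k e) → ∀ e → ⟦ l ⟧ f e ≡ ⟦ l ⟧ g e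
  ⟦⟧-cong []            f≗g e = refl
  ⟦⟧-cong ((k , a) ∷ l) f≗g e = cong₂ _+_ (f≗g k (e - + a)) (⟦⟧-cong l f≗g e)

  ⟦⟧-+ : ∀ l f g e → ⟦ l ⟧ (λ k e → f k e + g k e) e ≡ ⟦ l ⟧ f e + ⟦ l ⟧ g e
  ⟦⟧-+ []            f g e = refl
  ⟦⟧-+ ((k , a) ∷ l) f g e = trans
    (cong (λ x → (f k e′ + g k e′) + x) (⟦⟧-+ l f g e))
    (interchange (f k e′) (g k e′) _ _)
    where e′ = e - + a

  ⟦⟧-neg : ∀ l f e → ⟦ l ⟧ (λ k e → - f k e) e ≡ - ⟦ l ⟧ f e
  ⟦⟧-neg []            f e = refl
  ⟦⟧-neg ((k , a) ∷ l) f e = trans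
    (cong (λ x → - f k (e - + a) + x) (⟦⟧-neg l f e))
    (sym (ℤ.neg-distrib-+ (f k (e - + a)) (⟦ l ⟧ f e)))

  ⟦⟧-minus : ∀ l f g e → ⟦ l ⟧ (λ k e → f k e - g k e) e ≡ ⟦ l ⟧ f e - ⟦ l ⟧ g e
  ⟦⟧-minus l f g e = trans (⟦⟧-+ l f (λ k e → - g k e) e) (cong (λ x → ⟦ l ⟧ f e + x) (⟦⟧-neg l g e))

  ⟦⟧-shift : ∀ l f a e → ⟦ l ⟧ (λ k e → f k (e - a)) e ≡ ⟦ l ⟧ f (e - a)
  ⟦⟧-shift []            f a e = refl
  ⟦⟧-shift ((k , b) ∷ l) f a e =
    cong₂ _+_ (cong (f k) (minus-comm e (+ b) a)) (⟦⟧-shift l f a e)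

  ⟦⟧-++ : ∀ l l′ f e → ⟦ l ++ l′ ⟧ f e ≡ ⟦ l ⟧ f e + ⟦ l′ ⟧ f e
  ⟦⟧-++ []            l′ f e = sym (ℤ.+-identityˡ _)
  ⟦⟧-++ ((k , a) ∷ l) l′ f e = trans
    (cong (λ x → f k (e - + a) + x) (⟦⟧-++ l l′ f e))
    (sym (ℤ.+-assoc (f k (e - + a)) _ _))

  ⟦⟧-map₁ : ∀ l f e → ⟦ map (map₁ suc) l ⟧ f e ≡ ⟦ l ⟧ (f ∘ suc) e
  ⟦⟧-map₁ []            f e = refl
  ⟦⟧-map₁ ((k , a) ∷ l) f e = cong (λ x → f (suc k) (e - + a) + x) (⟦⟧-map₁ l f e)

  ⟦⟧-map₂ : ∀ l b f e → ⟦ map (map₂ (b ℕ.+_)) l ⟧ f e ≡ ⟦ l ⟧ f (e - + b)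
  ⟦⟧-map₂ []            b f e = refl
  ⟦⟧-map₂ ((k , a) ∷ l) b f e = cong₂ _+_ (cong (f k) (x e (+ b) (+ a))) (⟦⟧-map₂ l b f e)
    where
    x : ∀ e b a → e - (b + a) ≡ e - b - a
    x = solve-∀

  -- With E the shift (E f) k = f (k + 1), W s evaluates (E + q) ⋯ (E + q^s) f at 0 and
  -- Ψ L evaluates (1 + q E) ⋯ (1 + q^L E) w at 0; by the q-binomial theorem these are
  -- Σ_m q^{m(m+1)/2} [s; m] f (s - m) and Σ_s q^{s(s+1)/2} [L; s] w s.
  W : ℕ → List (ℕ × ℕ)
  W zero    = (0 , 0) ∷ []
  W (suc s) = map (map₁ suc) (W s) ++ map (map₂ (suc s ℕ.+_)) (W s)

  Ψ : ℕ → List (ℕ × ℕ)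
  Ψ zero    = (0 , 0) ∷ []
  Ψ (suc L) = Ψ L ++ map (map₁ suc) (map (map₂ (suc L ℕ.+_)) (Ψ L))

  ⟦⟧-one : ∀ f e → ⟦ (0 , 0) ∷ [] ⟧ f e ≡ f 0 e
  ⟦⟧-one f e = trans (ℤ.+-identityʳ _) (cong (f 0) (ℤ.+-identityʳ e))

  W-suc : ∀ s f e → ⟦ W (suc s) ⟧ f e ≡ ⟦ W s ⟧ (f ∘ suc) e + ⟦ W s ⟧ f (e - + suc s)
  W-suc s f e = trans (⟦⟧-++ (map (map₁ suc) (W s)) _ f e)
    (cong₂ _+_ (⟦⟧-map₁ (W s) f e) (⟦⟧-map₂ (W s) (suc s) f e))

  Ψ-suc : ∀ L f e → ⟦ Ψ (suc L) ⟧ f e ≡ ⟦ Ψ L ⟧ f e + ⟦ Ψ L ⟧ (f ∘ suc) (e - + suc L)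
  Ψ-suc L f e = trans (⟦⟧-++ (Ψ L) _ f e)
    (cong (λ x → ⟦ Ψ L ⟧ f e + x)
      (trans (⟦⟧-map₁ (map (map₂ (suc L ℕ.+_)) (Ψ L)) f e) (⟦⟧-map₂ (Ψ L) (suc L) (f ∘ suc) e)))

  -- The q-Leibniz rule for multiplication by x: 1 - q^{k+1} = q (1 - q^k) + (1 - q).
  Δ-suc : ∀ f k e → Δ f (suc k) e ≡ Δ (f ∘ suc) k (e - 1ℤ) + (f k e - f k (e - 1ℤ))
  Δ-suc f zero    e = sym (ℤ.+-identityˡ _)
  Δ-suc f (suc k) e = trans
    (cong (λ y → f (suc k) e - f (suc k) y) (x e (+ k)))
    (cancel (f (suc k) e) (f (suc k) (e - 1ℤ)) _)
    where
    x : ∀ e k → e - (1ℤ + (1ℤ + k)) ≡ e - 1ℤ - (1ℤ + k)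
    x = solve-∀
    cancel : ∀ a b c → a - c ≡ (b - c) + (a - b)
    cancel = solve-∀

  -- With x^k in place of `f k`, `Δ` is the q-difference operator p(x) ↦ (p(x) - p(qx)) / x. It
  -- sends (x + q) ⋯ (x + q^s) to (1 - q^s) (x + q) ⋯ (x + q^{s-1}), just as it sends x^s to (1 -
  -- q^s) x^{s-1}.
  W-Δ : ∀ s f e → ⟦ W s ⟧ (Δ f) e ≡ Δ (λ s → ⟦ W s ⟧ f) s e
  W-Δ zero    f e = refl
  W-Δ (suc s) f e = begin
    ⟦ W (suc s) ⟧ (Δ f) e
      ≡⟨ W-suc s (Δ f) e ⟩
    ⟦ W s ⟧ (Δ f ∘ suc) e + ⟦ W s ⟧ (Δ f) (e - + suc s)
      ≡⟨ cong₂ _+_ first (W-Δ s f (e - + suc s)) ⟩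
    (Δ (λ s → ⟦ W s ⟧ (f ∘ suc)) s (e - 1ℤ) + (F e - F (e - 1ℤ))) + Δ (λ s → ⟦ W s ⟧ f) s (e - + suc s)
      ≡⟨ last s ⟩
    F e - F (e - + suc s) ∎
    where
    open ≡-Reasoning
    F = ⟦ W s ⟧ f
    first : ⟦ W s ⟧ (Δ f ∘ suc) e ≡ Δ (λ s → ⟦ W s ⟧ (f ∘ suc)) s (e - 1ℤ) + (F e - F (e - 1ℤ))
    first = begin
      ⟦ W s ⟧ (Δ f ∘ suc) e
        ≡⟨ ⟦⟧-cong (W s) (Δ-suc f) e ⟩
      ⟦ W s ⟧ (λ k e → Δ (f ∘ suc) k (e - 1ℤ) + (f k e - f k (e - 1ℤ))) e
        ≡⟨ ⟦⟧-+ (W s) (λ k e → Δ (f ∘ suc) k (e - 1ℤ)) (λ k e → f k e - f k (e - 1ℤ)) e ⟩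
      ⟦ W s ⟧ (λ k e → Δ (f ∘ suc) k (e - 1ℤ)) e + ⟦ W s ⟧ (λ k e → f k e - f k (e - 1ℤ)) e
        ≡⟨ cong₂ _+_
             (trans (⟦⟧-shift (W s) (Δ (f ∘ suc)) 1ℤ e) (W-Δ s (f ∘ suc) (e - 1ℤ)))
             (trans (⟦⟧-minus (W s) f (λ k e → f k (e - 1ℤ)) e)
                    (cong (λ x → F e - x) (⟦⟧-shift (W s) f 1ℤ e))) ⟩
      Δ (λ s → ⟦ W s ⟧ (f ∘ suc)) s (e - 1ℤ) + (F e - F (e - 1ℤ)) ∎
    last : ∀ s → let F = ⟦ W s ⟧ f in
      (Δ (λ s → ⟦ W s ⟧ (f ∘ suc)) s (e - 1ℤ) + (F e - F (e - 1ℤ))) + Δ (λ s → ⟦ W s ⟧ f) s (e - + suc s)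
      ≡ F e - F (e - + suc s)
    last zero    = trans (ℤ.+-identityʳ _) (ℤ.+-identityˡ _)
    last (suc t) = begin
      ((A (e - 1ℤ) - A (e - 1ℤ - + suc t)) + (F′ e - F′ (e - 1ℤ))) + (B (e - s′) - B (e - s′ - + suc t))
        ≡⟨ cong₂ (λ y z → ((A (e - 1ℤ) - y) + (F′ e - z)) + (B (e - s′) - B (e - s′ - + suc t)))
             (cong A (x₁ e (+ t))) (W-suc t f (e - 1ℤ)) ⟩
      ((A (e - 1ℤ) - A (e - s′)) + (F′ e - (A (e - 1ℤ) + B (e - 1ℤ - + suc t)))) + (B (e - s′) - B (e - s′ - + suc t))
        ≡⟨ cong (λ y → ((A (e - 1ℤ) - A (e - s′)) + (F′ e - (A (e - 1ℤ) + y))) + (B (e - s′) - B (e - s′ - + suc t)))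
             (cong B (x₁ e (+ t))) ⟩
      ((A (e - 1ℤ) - A (e - s′)) + (F′ e - (A (e - 1ℤ) + B (e - s′)))) + (B (e - s′) - B (e - s′ - + suc t))
        ≡⟨ cancel (A (e - 1ℤ)) (A (e - s′)) (F′ e) (B (e - s′)) (B (e - s′ - + suc t)) ⟩
      F′ e - (A (e - s′) + B (e - s′ - + suc t))
        ≡⟨ cong (λ y → F′ e - y) (W-suc t f (e - s′)) ⟨
      F′ e - F′ (e - s′) ∎
      where
      A = ⟦ W t ⟧ (f ∘ suc)
      B = ⟦ W t ⟧ f
      F′ = ⟦ W (suc t) ⟧ f
      s′ = + suc (suc t)
      x₁ : ∀ e t → e - 1ℤ - (1ℤ + t) ≡ e - (1ℤ + (1ℤ + t))
      x₁ = solve-∀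
      cancel : ∀ a a′ F b b′ → ((a - a′) + (F - (a + b))) + (b - b′) ≡ F - (a′ + b′)
      cancel = solve-∀

  -- The defect of the expansion: up to a factor q^{L+1}, what separates multiplication by 1 +
  -- q^{2L+2} + q^{L+1} X from the new factor 1 + q^{L+1} E of `Ψ (suc L)`; see `w-X` in
  -- `P-expansion`.
  Φ : ℕ → (ℕ → Laurent) → (ℕ → Laurent)
  Φ L w s e = (w s (e - + suc L) - w s (e - + suc s)) + Δ w s e

  -- (1 + q^{L+1} E) Φ_{L+1} = Φ_L (1 + q^{L+2} E), and Φ_0 vanishes at 0.
  Ψ-Φ : ∀ L w e → ⟦ Ψ L ⟧ (Φ L w) e ≡ 0ℤ
  Ψ-Φ zero    w e = trans (⟦⟧-one (Φ 0 w) e) (trans (ℤ.+-identityʳ _) (ℤ.+-inverseʳ (w 0 (e - 1ℤ))))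
  Ψ-Φ (suc L) w e = begin
    ⟦ Ψ (suc L) ⟧ Φ′ e
      ≡⟨ Ψ-suc L Φ′ e ⟩
    ⟦ Ψ L ⟧ Φ′ e + ⟦ Ψ L ⟧ (Φ′ ∘ suc) (e - + suc L)
      ≡⟨ cong (λ x → ⟦ Ψ L ⟧ Φ′ e + x) (⟦⟧-shift (Ψ L) (Φ′ ∘ suc) (+ suc L) e) ⟨
    ⟦ Ψ L ⟧ Φ′ e + ⟦ Ψ L ⟧ (λ s e → Φ′ (suc s) (e - + suc L)) e
      ≡⟨ ⟦⟧-+ (Ψ L) Φ′ (λ s e → Φ′ (suc s) (e - + suc L)) e ⟨
    ⟦ Ψ L ⟧ (λ s e → Φ′ s e + Φ′ (suc s) (e - + suc L)) e
      ≡⟨ ⟦⟧-cong (Ψ L) step e ⟩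
    ⟦ Ψ L ⟧ (Φ L w′) e
      ≡⟨ Ψ-Φ L w′ e ⟩
    0ℤ ∎
    where
    open ≡-Reasoning
    Φ′ = Φ (suc L) w
    L₁ = + suc L
    L₂ = + suc (suc L)
    w′ : ℕ → Laurent
    w′ s e = w s e + w (suc s) (e - L₂)
    x₁ : ∀ e L → e - (1ℤ + (1ℤ + L)) ≡ e - (1ℤ + L) - 1ℤ
    x₁ = solve-∀
    x₂ : ∀ e L s → e - (1ℤ + L) - (1ℤ + (1ℤ + s)) ≡ e - (1ℤ + s) - (1ℤ + (1ℤ + L))
    x₂ = solve-∀
    arrange₀ : ∀ p b c d a → ((p - b) + 0ℤ) + ((c - d) + (a - p)) ≡ ((a + c) - (b + d)) + 0ℤ
    arrange₀ = solve-∀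
    arrange₁ : ∀ p b c d a r t t′ → ((p - b) + (t - t′)) + ((c - d) + (a - r)) ≡
          ((a + c) - (b + d)) + ((t + p) - (t′ + r))
    arrange₁ = solve-∀
    step : ∀ s e → Φ′ s e + Φ′ (suc s) (e - L₁) ≡ Φ L w′ s e
    step zero e = trans
      (cong₂ (λ y z → ((w 0 (e - L₂) - w 0 (e - 1ℤ)) + 0ℤ) + ((w 1 (e - L₁ - L₂) - y) + (w 0 (e - L₁) - z)))
        (cong (w 1) (x₂ e (+ L) 0ℤ)) (cong (w 0) (sym (x₁ e (+ L)))))
      (arrange₀ (w 0 (e - L₂)) (w 0 (e - 1ℤ)) (w 1 (e - L₁ - L₂)) (w 1 (e - 1ℤ - L₂)) (w 0 (e - L₁)))
    step (suc t) e = trans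
      (cong₂ (λ y z → ((w s (e - L₂) - w s (e - + suc s)) + (w t e - w t (e - + s))) +
                      ((w (suc s) (e - L₁ - L₂) - y) + (w s (e - L₁) - z)))
        (cong (w (suc s)) (x₂ e (+ L) (+ s))) (cong (w s) (x₂ e (+ L) (+ t))))
      (arrange₁ (w s (e - L₂)) (w s (e - + suc s)) (w (suc s) (e - L₁ - L₂)) (w (suc s) (e - + suc s - L₂))
           (w s (e - L₁)) (w s (e - + s - L₂)) (w t e) (w t (e - + s)))
      where s = suc t

  -- Expansion of q^{T(j)} [2L+1; L-j] in q-Hermite polynomials

  -- In this form `suc (double (suc L))` computes to two further successors, which lets `P-suc`
  -- apply Pascal's rule twice without rewriting.
  double : ℕ → ℕ
  double zero    = zero
  double (suc n) = suc (suc (double n))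

  +-double : ∀ n → + double n ≡ + n + + n
  +-double zero    = refl
  +-double (suc n) = trans (cong (λ x → 1ℤ + (1ℤ + x)) (+-double n)) (x (+ n))
    where
    x : ∀ n → 1ℤ + (1ℤ + (n + n)) ≡ (1ℤ + n) + (1ℤ + n)
    x = solve-∀

  tri : ℕ → ℕ
  tri zero    = zero
  tri (suc n) = suc n ℕ.+ tri n

  T : ℤ → ℤ
  T (+ n)    = + tri n
  T -[1+ n ] = + tri n

  T-double : ∀ j → T j + T j ≡ j * (j + 1ℤ)
  T-double (+ n) = onℕ n
    where
    x : ∀ n → (1ℤ + n) + (1ℤ + n) + n * (n + 1ℤ) ≡ (1ℤ + n) * ((1ℤ + n) + 1ℤ)
    x = solve-∀
    onℕ : ∀ n → + tri n + + tri n ≡ + n * (+ n + 1ℤ)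
    onℕ zero    = refl
    onℕ (suc n) = trans (interchange (+ suc n) (+ tri n) (+ suc n) (+ tri n))
      (trans (cong (λ y → + suc n + + suc n + y) (onℕ n)) (x (+ n)))
  T-double -[1+ n ] = trans (T-double (+ n)) (x (+ n))
    where
    x : ∀ n → n * (n + 1ℤ) ≡ (- (1ℤ + n)) * (- (1ℤ + n) + 1ℤ)
    x = solve-∀

  -- Comparing doubles removes the halving in T, so that identities for T become polynomial
  -- identities over ℤ.
  T-unique : ∀ j t → t + t ≡ j * (j + 1ℤ) → T j ≡ t
  T-unique j t eq = ℤ.*-cancelˡ-≡ (+ 2) (T j) t 
    (trans (x (T j)) (trans (T-double j) (trans (sym eq) (sym (x t)))))
    where
    x : ∀ a → + 2 * a ≡ a + a
    x = solve-∀

  T-translate : ∀ j k d → j * (j + 1ℤ) + (d + d) ≡ k * (k + 1ℤ) → T k ≡ T j + d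
  T-translate j k d eq = T-unique k (T j + d)
    (trans (interchange (T j) d (T j) d) (trans (cong (_+ (d + d)) (T-double j)) eq))

  T-+1 : ∀ j → T (j + 1ℤ) ≡ T j + (j + 1ℤ)
  T-+1 j = T-translate j (j + 1ℤ) (j + 1ℤ) (x j)
    where
    x : ∀ j → j * (j + 1ℤ) + (j + 1ℤ + (j + 1ℤ)) ≡ (j + 1ℤ) * (j + 1ℤ + 1ℤ)
    x = solve-∀

  T--1 : ∀ j → T (j - 1ℤ) ≡ T j + - j
  T--1 j = T-translate j (j - 1ℤ) (- j) (x j)
    where
    x : ∀ j → j * (j + 1ℤ) + (- j + - j) ≡ (j - 1ℤ) * (j - 1ℤ + 1ℤ)
    x = solve-∀

  T-neg : ∀ j → T (- j) ≡ T j + - j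
  T-neg j = T-translate j (- j) (- j) (x j)
    where
    x : ∀ j → j * (j + 1ℤ) + (- j + - j) ≡ - j * (- j + 1ℤ)
    x = solve-∀

  P : ℕ → ℤ → Laurent
  P L j e = gauss (suc (double L)) (+ L - j) (e - T j)

  -- Both sides live at j = 0 and j = -1: on the left since T vanishes at both, on the right since
  -- `half` sends 0 and 1 to 0.
  P-zero : ∀ j e → P 0 j e ≡ H 0 j e
  P-zero (+ 0) e = trans (ℤ.+-identityʳ _) (cong (δ 0ℤ) (ℤ.+-identityʳ e))
  P-zero (+ suc n) e = refl
  P-zero -[1+ 0 ] e = trans (ℤ.+-identityˡ _) (cong (δ 0ℤ) (x e))
    where
    x : ∀ e → e - 0ℤ - 0ℤ ≡ e
    x = solve-∀
  P-zero -[1+ suc n ] e = refl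

  -- Two Pascal steps give four terms with powers of q that depend on j. The weight q^{T(j)} is
  -- chosen so that T(j+1) - T(j) = j + 1 and T(j-1) - T(j) = -j absorb this dependence.
  P-suc : ∀ L j e → P (suc L) j e ≡
    (P L j e + P L j (e - + suc L - + suc L)) + (P L (j - 1ℤ) (e - + suc L) + P L (j + 1ℤ) (e - + suc L))
  P-suc L j e = begin
    gauss (suc (suc N₁)) m x
      ≡⟨ pascal (suc N₁) m x ⟩
    (gauss N₁ (m - 1ℤ) x + gauss N₁ (m - 1ℤ - 1ℤ) (x - (+ suc N₁ - (m - 1ℤ)))) +
    (gauss N₁ m (x - m) + gauss N₁ (m - 1ℤ) (x - m - (+ suc N₁ - m)))
      ≡⟨ cong₂ _+_
           (cong₂ _+_ (cong (λ i → gauss N₁ i x) (m₀ (+ L) j))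
                      (cong₂ (gauss N₁) (m₊ (+ L) j) x₊))
           (cong₂ _+_ (cong₂ (gauss N₁) (m₋ (+ L) j) x₋)
                      (cong₂ (gauss N₁) (m₀ (+ L) j) x₀)) ⟩
    (P L j e + P L (j + 1ℤ) (e - + suc L)) + (P L (j - 1ℤ) (e - + suc L) + P L j (e - + suc L - + suc L))
      ≡⟨ arrange (P L j e) (P L (j + 1ℤ) (e - + suc L)) (P L (j - 1ℤ) (e - + suc L)) (P L j (e - + suc L - + suc L)) ⟩
    (P L j e + P L j (e - + suc L - + suc L)) + (P L (j - 1ℤ) (e - + suc L) + P L (j + 1ℤ) (e - + suc L)) ∎
    where
    open ≡-Reasoning
    N₁ = suc (double L)
    m = + suc L - j
    x = e - T j
    arrange : ∀ a b c d → (a + b) + (c + d) ≡ (a + d) + (c + b)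
    arrange = solve-∀
    m₀ : ∀ L j → 1ℤ + L - j - 1ℤ ≡ L - j
    m₀ = solve-∀
    m₊ : ∀ L j → 1ℤ + L - j - 1ℤ - 1ℤ ≡ L - (j + 1ℤ)
    m₊ = solve-∀
    m₋ : ∀ L j → 1ℤ + L - j ≡ L - (j - 1ℤ)
    m₋ = solve-∀
    x₊′ : ∀ e t L j → e - t - ((1ℤ + (1ℤ + (L + L))) - (1ℤ + L - j - 1ℤ)) ≡ e - (1ℤ + L) - (t + (j + 1ℤ))
    x₊′ = solve-∀
    x₊ : x - (+ suc N₁ - (m - 1ℤ)) ≡ e - + suc L - T (j + 1ℤ)
    x₊ = trans (cong (λ d → x - (1ℤ + (1ℤ + d) - (m - 1ℤ))) (+-double L))
      (trans (x₊′ e (T j) (+ L) j) (cong (λ t → e - + suc L - t) (sym (T-+1 j))))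
    x₋′ : ∀ e t L j → e - t - (1ℤ + L - j) ≡ e - (1ℤ + L) - (t + - j)
    x₋′ = solve-∀
    x₋ : x - m ≡ e - + suc L - T (j - 1ℤ)
    x₋ = trans (x₋′ e (T j) (+ L) j) (cong (λ t → e - + suc L - t) (sym (T--1 j)))
    x₀′ : ∀ e t L j → e - t - (1ℤ + L - j) - ((1ℤ + (1ℤ + (L + L))) - (1ℤ + L - j)) ≡ e - (1ℤ + L) - (1ℤ + L) - t
    x₀′ = solve-∀
    x₀ : x - m - (+ suc N₁ - m) ≡ e - + suc L - + suc L - T j
    x₀ = trans (cong (λ d → x - m - (1ℤ + (1ℤ + d) - m)) (+-double L)) (x₀′ e (T j) (+ L) j)

  P-expansion : ∀ L j e → P L j e ≡ ⟦ Ψ L ⟧ (λ s → ⟦ W s ⟧ (λ k → H k j)) e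
  P-expansion zero    j e = trans (P-zero j e)
    (sym (trans (⟦⟧-one (λ s → ⟦ W s ⟧ (λ k → H k j)) e) (⟦⟧-one (λ k → H k j) e)))
  P-expansion (suc L) j e = begin
    P (suc L) j e
      ≡⟨ P-suc L j e ⟩
    (P L j e + P L j (e₁ - + suc L)) + (P L (j - 1ℤ) e₁ + P L (j + 1ℤ) e₁)
      ≡⟨ cong₂ _+_ (cong₂ _+_ (P-expansion L j e) (P-expansion L j (e₁ - + suc L)))
           (trans (cong₂ _+_ (P-expansion L (j - 1ℤ) e₁) (P-expansion L (j + 1ℤ) e₁))
                  (sym (⟦⟧-+ (Ψ L) (w (j - 1ℤ)) (w (j + 1ℤ)) e₁))) ⟩
    (⟦ Ψ L ⟧ (w j) e + ⟦ Ψ L ⟧ (w j) (e₁ - + suc L)) + ⟦ Ψ L ⟧ (λ s e → w (j - 1ℤ) s e + w (j + 1ℤ) s e) e₁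
      ≡⟨ cong (λ y → (⟦ Ψ L ⟧ (w j) e + ⟦ Ψ L ⟧ (w j) (e₁ - + suc L)) + y) X-part ⟩
    (⟦ Ψ L ⟧ (w j) e + ⟦ Ψ L ⟧ (w j) (e₁ - + suc L)) + (⟦ Ψ L ⟧ (w j ∘ suc) e₁ - ⟦ Ψ L ⟧ (w j) (e₁ - + suc L))
      -- The q^{2L+2} term of the recurrence disappears here, leaving the two positive terms of
      -- `Ψ-suc`.
      ≡⟨ cancel (⟦ Ψ L ⟧ (w j) e) (⟦ Ψ L ⟧ (w j) (e₁ - + suc L)) _ ⟩
    ⟦ Ψ L ⟧ (w j) e + ⟦ Ψ L ⟧ (w j ∘ suc) e₁
      ≡⟨ Ψ-suc L (w j) e ⟨
    ⟦ Ψ (suc L) ⟧ (w j) e ∎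
    where
    open ≡-Reasoning
    e₁ = e - + suc L
    w : ℤ → ℕ → Laurent
    w j s = ⟦ W s ⟧ (λ k → H k j)
    cancel : ∀ a b c → (a + b) + (c - b) ≡ a + c
    cancel = solve-∀
    arrange : ∀ p q r d → p + d ≡ (p + q) - r + ((r - q) + d)
    arrange = solve-∀
    w-X : ∀ s e → w (j - 1ℤ) s e + w (j + 1ℤ) s e ≡ (w j (suc s) e - w j s (e - + suc L)) + Φ L (w j) s e
    w-X s e = begin
      w (j - 1ℤ) s e + w (j + 1ℤ) s e
        ≡⟨ ⟦⟧-+ (W s) (λ k → H k (j - 1ℤ)) (λ k → H k (j + 1ℤ)) e ⟨
      ⟦ W s ⟧ (λ k e → H k (j - 1ℤ) e + H k (j + 1ℤ) e) e
        ≡⟨ ⟦⟧-cong (W s) (λ k → H-X k j) e ⟩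
      ⟦ W s ⟧ (λ k e → H (suc k) j e + Δ (λ k → H k j) k e) e
        ≡⟨ ⟦⟧-+ (W s) (λ k → H (suc k) j) (Δ (λ k → H k j)) e ⟩
      ⟦ W s ⟧ (λ k → H (suc k) j) e + ⟦ W s ⟧ (Δ (λ k → H k j)) e
        ≡⟨ cong (λ y → ⟦ W s ⟧ (λ k → H (suc k) j) e + y) (W-Δ s (λ k → H k j) e) ⟩
      ⟦ W s ⟧ (λ k → H (suc k) j) e + Δ (w j) s e
        ≡⟨ arrange (⟦ W s ⟧ (λ k → H (suc k) j) e) (w j s (e - + suc s)) (w j s (e - + suc L)) (Δ (w j) s e) ⟩
      (⟦ W s ⟧ (λ k → H (suc k) j) e + w j s (e - + suc s)) - w j s (e - + suc L) + Φ L (w j) s e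
        ≡⟨ cong (λ y → y - w j s (e - + suc L) + Φ L (w j) s e) (W-suc s (λ k → H k j) e) ⟨
      (w j (suc s) e - w j s (e - + suc L)) + Φ L (w j) s e ∎
    X-part : ⟦ Ψ L ⟧ (λ s e → w (j - 1ℤ) s e + w (j + 1ℤ) s e) e₁ ≡
             ⟦ Ψ L ⟧ (w j ∘ suc) e₁ - ⟦ Ψ L ⟧ (w j) (e₁ - + suc L)
    X-part = begin
      ⟦ Ψ L ⟧ (λ s e → w (j - 1ℤ) s e + w (j + 1ℤ) s e) e₁
        ≡⟨ ⟦⟧-cong (Ψ L) w-X e₁ ⟩
      ⟦ Ψ L ⟧ (λ s e → (w j (suc s) e - w j s (e - + suc L)) + Φ L (w j) s e) e₁
        ≡⟨ ⟦⟧-+ (Ψ L) (λ s e → w j (suc s) e - w j s (e - + suc L)) (Φ L (w j)) e₁ ⟩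
      ⟦ Ψ L ⟧ (λ s e → w j (suc s) e - w j s (e - + suc L)) e₁ + ⟦ Ψ L ⟧ (Φ L (w j)) e₁
        ≡⟨ cong₂ _+_
             (trans (⟦⟧-minus (Ψ L) (w j ∘ suc) (λ s e → w j s (e - + suc L)) e₁)
                    (cong (λ y → ⟦ Ψ L ⟧ (w j ∘ suc) e₁ - y) (⟦⟧-shift (Ψ L) (w j) (+ suc L) e₁)))
             (Ψ-Φ L (w j) e₁) ⟩
      ⟦ Ψ L ⟧ (w j ∘ suc) e₁ - ⟦ Ψ L ⟧ (w j) (e₁ - + suc L) + 0ℤ
        ≡⟨ ℤ.+-identityʳ _ ⟩
      ⟦ Ψ L ⟧ (w j ∘ suc) e₁ - ⟦ Ψ L ⟧ (w j) (e₁ - + suc L) ∎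

  -- Bilateral alternating sums

  sgn : ℤ → ℤ
  sgn i = -1ℤ ^ ∣ i ∣

  Σ±-cong : ∀ b {f g} → (∀ i → f i ≡ g i) → Σ± b f ≡ Σ± b g
  Σ±-cong zero    f≗g = f≗g 0ℤ
  Σ±-cong (suc b) f≗g = cong₂ _+_ (Σ±-cong b f≗g) (cong₂ _+_ (f≗g (+ suc b)) (f≗g -[1+ b ]))

  Σ±-+ : ∀ b f g → Σ± b (λ i → f i + g i) ≡ Σ± b f + Σ± b g
  Σ±-+ zero    f g = refl
  Σ±-+ (suc b) f g = trans
    (cong₂ _+_ (Σ±-+ b f g) (interchange (f (+ suc b)) (g (+ suc b)) (f -[1+ b ]) (g -[1+ b ])))
    (interchange (Σ± b f) (Σ± b g) (f (+ suc b) + f -[1+ b ]) (g (+ suc b) + g -[1+ b ]))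

  Σ±-zero : ∀ b {f} → (∀ i → f i ≡ 0ℤ) → Σ± b f ≡ 0ℤ
  Σ±-zero zero    f≡0 = f≡0 0ℤ
  Σ±-zero (suc b) f≡0 = cong₂ _+_ (Σ±-zero b f≡0) (cong₂ _+_ (f≡0 (+ suc b)) (f≡0 -[1+ b ]))

  Σ±-single : ∀ b {f} → (∀ n → f (+ suc n) ≡ 0ℤ) → (∀ n → f -[1+ n ] ≡ 0ℤ) → Σ± b f ≡ f 0ℤ
  Σ±-single zero    f₊ f₋ = refl
  Σ±-single (suc b) f₊ f₋ =
    trans (cong₂ _+_ (Σ±-single b f₊ f₋) (cong₂ _+_ (f₊ b) (f₋ b))) (ℤ.+-identityʳ _)

  Σ±-neg : ∀ b f → Σ± b (λ i → f (- i)) ≡ Σ± b f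
  Σ±-neg zero    f = refl
  Σ±-neg (suc b) f = cong₂ _+_ (Σ±-neg b f) (ℤ.+-comm (f -[1+ b ]) (f (+ suc b)))

  -- The map i ↦ -1 - i carries the window from -b to b onto the one from -b - 1 to b - 1, hence one
  -- correction term at each end.
  Σ±-reflect : ∀ b f → Σ± b (λ i → f (-1ℤ - i)) + f (+ b) ≡ Σ± b f + f -[1+ b ]
  Σ±-reflect zero    f = ℤ.+-comm (f -1ℤ) (f 0ℤ)
  Σ±-reflect (suc b) f = begin
    (Σ± b f′ + (f -[1+ suc b ] + f (+ b))) + f (+ suc b)
      ≡⟨ arrange₁ (Σ± b f′) (f -[1+ suc b ]) (f (+ b)) (f (+ suc b)) ⟩
    (Σ± b f′ + f (+ b)) + (f (+ suc b) + f -[1+ suc b ])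
      ≡⟨ cong (_+ (f (+ suc b) + f -[1+ suc b ])) (Σ±-reflect b f) ⟩
    (Σ± b f + f -[1+ b ]) + (f (+ suc b) + f -[1+ suc b ])
      ≡⟨ arrange₂ (Σ± b f) (f -[1+ b ]) (f (+ suc b)) (f -[1+ suc b ]) ⟩
    (Σ± b f + (f (+ suc b) + f -[1+ b ])) + f -[1+ suc b ] ∎
    where
    open ≡-Reasoning
    f′ : ℤ → ℤ
    f′ i = f (-1ℤ - i)
    arrange₁ : ∀ a b c d → (a + (b + c)) + d ≡ (a + c) + (d + b)
    arrange₁ = solve-∀
    arrange₂ : ∀ a b c d → (a + b) + (c + d) ≡ (a + (c + b)) + d
    arrange₂ = solve-∀

  ⟦⟧-Σ± : ∀ l b (c a : ℤ → ℤ) (F : ℤ → ℕ → Laurent) e →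
    ⟦ l ⟧ (λ k e → Σ± b (λ i → c i * F i k (e - a i))) e ≡ Σ± b (λ i → c i * ⟦ l ⟧ (F i) (e - a i))
  ⟦⟧-Σ± []            b c a F e = sym (Σ±-zero b (λ i → ℤ.*-zeroʳ (c i)))
  ⟦⟧-Σ± ((k , m) ∷ l) b c a F e = begin
    Σ± b (λ i → c i * F i k (e - + m - a i)) + ⟦ l ⟧ (λ k e → Σ± b (λ i → c i * F i k (e - a i))) e
      ≡⟨ cong (λ x → Σ± b (λ i → c i * F i k (e - + m - a i)) + x) (⟦⟧-Σ± l b c a F e) ⟩
    Σ± b (λ i → c i * F i k (e - + m - a i)) + Σ± b (λ i → c i * ⟦ l ⟧ (F i) (e - a i))
      ≡⟨ Σ±-+ b (λ i → c i * F i k (e - + m - a i)) _ ⟨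
    Σ± b (λ i → c i * F i k (e - + m - a i) + c i * ⟦ l ⟧ (F i) (e - a i))
      ≡⟨ Σ±-cong b (λ i → trans
           (sym (ℤ.*-distribˡ-+ (c i) (F i k (e - + m - a i)) (⟦ l ⟧ (F i) (e - a i))))
           (cong (λ y → c i * (F i k y + ⟦ l ⟧ (F i) (e - a i))) (minus-comm e (+ m) (a i)))) ⟩
    Σ± b (λ i → c i * ⟦ (k , m) ∷ l ⟧ (F i) (e - a i)) ∎
    where open ≡-Reasoning

  sgn-neg : ∀ i → sgn (- i) ≡ sgn i
  sgn-neg i = cong (-1ℤ ^_) (ℤ.∣-i∣≡∣i∣ i)

  sgn-reflect : ∀ i → sgn (-1ℤ - i) ≡ - sgn i
  sgn-reflect (+ 0) = refl
  sgn-reflect (+ suc n) = ℤ.-1*i≡-i (sgn (+ suc n))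
  sgn-reflect -[1+ n ] = trans (sym (ℤ.neg-involutive (sgn (+ n)))) (cong -_ (sym (ℤ.-1*i≡-i (sgn (+ n)))))

  T-reflect : ∀ i → T (-1ℤ - i) ≡ T i
  T-reflect (+ 0) = refl
  T-reflect (+ suc n) = refl
  T-reflect -[1+ n ] = refl

  -- κ i = i (5 i + 1) / 2.
  κ : ℤ → ℤ
  κ i = i * i + i * i + T i

  module _ (b : ℕ) where

    -- Pascal's rule and the reflections i ↦ -i and i ↦ -1 - i act on this family by
    -- changing the integer parameters.
    θ : ℕ → (m u v : ℤ) → Laurent
    θ k m u v e = Σ± b (λ i → sgn i * gauss k (m - (i + i)) (e - (κ i + (u + v * i))))

    θ-cong : ∀ k v {m m′ u u′} e → m ≡ m′ → u ≡ u′ → θ k m u v e ≡ θ k m′ u′ v e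
    θ-cong k v e refl refl = refl

    θ-shift : ∀ k m u v e → θ k m u v e ≡ θ k m 0ℤ v (e - u)
    θ-shift k m u v e = Σ±-cong b λ i → cong (λ y → sgn i * gauss k (m - (i + i)) y) (x e (κ i) u (v * i))
      where
      x : ∀ e t u w → e - (t + (u + w)) ≡ e - u - (t + (0ℤ + w))
      x = solve-∀

    θ-pascal₁ : ∀ k m u v e →
      θ (suc k) m u v e ≡ θ k m u v e + θ k (m - 1ℤ) (u + (+ suc k - m)) (v + + 2) e
    θ-pascal₁ k m u v e = trans
      (Σ±-cong b λ i → trans (ℤ.*-distribˡ-+ (sgn i) (gauss k (m - (i + i)) (y i)) _)
        (cong (λ x → sgn i * gauss k (m - (i + i)) (y i) + sgn i * x)
          (cong₂ (gauss k) (x₁ m i) (x₂ e (κ i) u v i (+ k) m))))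
      (Σ±-+ b (λ i → sgn i * gauss k (m - (i + i)) (y i)) _)
      where
      y : ℤ → ℤ
      y i = e - (κ i + (u + v * i))
      x₁ : ∀ m i → m - (i + i) - 1ℤ ≡ m - 1ℤ - (i + i)
      x₁ = solve-∀
      x₂ : ∀ e t u v i k m → e - (t + (u + v * i)) - (1ℤ + k - (m - (i + i))) ≡
                             e - (t + (u + (1ℤ + k - m) + (v + + 2) * i))
      x₂ = solve-∀

    θ-pascal₂ : ∀ k m u v e →
      θ (suc k) m u v e ≡ θ k (m - 1ℤ) u v e + θ k m (u + m) (v - + 2) e
    θ-pascal₂ k m u v e = trans
      (Σ±-cong b λ i → trans (cong (sgn i *_) (pascal k (m - (i + i)) (y i)))
        (trans (ℤ.*-distribˡ-+ (sgn i) (gauss k (m - (i + i) - 1ℤ) (y i)) _)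
          (cong₂ (λ a c → sgn i * gauss k a (y i) + sgn i * gauss k (m - (i + i)) c)
            (x₁ m i) (x₂ e (κ i) u v i m))))
      (Σ±-+ b (λ i → sgn i * gauss k (m - 1ℤ - (i + i)) (y i)) _)
      where
      y : ℤ → ℤ
      y i = e - (κ i + (u + v * i))
      x₁ : ∀ m i → m - (i + i) - 1ℤ ≡ m - 1ℤ - (i + i)
      x₁ = solve-∀
      x₂ : ∀ e t u v i m → e - (t + (u + v * i)) - (m - (i + i)) ≡ e - (t + ((u + m) + (v - + 2) * i))
      x₂ = solve-∀

    -- Uses κ(-i) = κ(i) - i and the symmetry of the binomial.
    θ-neg : ∀ k m u v e → θ k m u v e ≡ θ k (+ k - m) u (-1ℤ - v) e
    θ-neg k m u v e = trans (sym (Σ±-neg b _)) (Σ±-cong b λ i →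
      cong₂ _*_ (sgn-neg i) (trans
        (sym (gauss-sym k (m - (- i + - i)) _))
        (cong₂ (gauss k) (x₁ (+ k) m i) (trans
          (cong (λ t → e - ((- i * - i + - i * - i + t) + (u + v * - i))) (T-neg i))
          (x₂ e (T i) u v i)))))
      where
      x₁ : ∀ k m i → k - (m - (- i + - i)) ≡ k - m - (i + i)
      x₁ = solve-∀
      x₂ : ∀ e t u v i → e - ((- i * - i + - i * - i + (t + - i)) + (u + v * - i)) ≡
                         e - ((i * i + i * i + t) + (u + (-1ℤ - v) * i))
      x₂ = solve-∀

    -- Uses κ(-1 - i) = κ(i) + 4i + 2; the minus sign comes from (-1)^i. The two vanishing
    -- hypotheses remove the end terms of `Σ±-reflect`.
    θ-reflect : ∀ k m u v e →
      (∀ y → gauss k (m - (+ b + + b)) y ≡ 0ℤ) → (∀ y → gauss k (m - (-[1+ b ] + -[1+ b ])) y ≡ 0ℤ) →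
      θ k m u v e ≡ - θ k (+ k - m - + 2) (u - v + + 2) (+ 4 - v) e
    θ-reflect k m u v e z₊ z₋ = begin
      Σ± b f
        ≡⟨ trans (sym (ℤ.+-identityʳ _)) (cong (λ y → Σ± b f + y) (sym f₋)) ⟩
      Σ± b f + f -[1+ b ]
        ≡⟨ Σ±-reflect b f ⟨
      Σ± b (λ i → f (-1ℤ - i)) + f (+ b)
        ≡⟨ trans (cong (λ y → Σ± b (λ i → f (-1ℤ - i)) + y) f₊) (ℤ.+-identityʳ _) ⟩
      Σ± b (λ i → f (-1ℤ - i))
        ≡⟨ Σ±-cong b reflected ⟩
      Σ± b (λ i → - g i)
        ≡⟨ negated b ⟩
      - Σ± b g ∎
      where
      open ≡-Reasoning
      f g : ℤ → ℤ
      f i = sgn i * gauss k (m - (i + i)) (e - (κ i + (u + v * i)))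
      g i = sgn i * gauss k (+ k - m - + 2 - (i + i)) (e - (κ i + (u - v + + 2 + (+ 4 - v) * i)))
      f₊ : f (+ b) ≡ 0ℤ
      f₊ = trans (cong (sgn (+ b) *_) (z₊ _)) (ℤ.*-zeroʳ (sgn (+ b)))
      f₋ : f -[1+ b ] ≡ 0ℤ
      f₋ = trans (cong (sgn -[1+ b ] *_) (z₋ _)) (ℤ.*-zeroʳ (sgn -[1+ b ]))
      negated : ∀ b → Σ± b (λ i → - g i) ≡ - Σ± b g
      negated zero    = refl
      negated (suc b) = trans
        (cong₂ _+_ (negated b) (sym (ℤ.neg-distrib-+ (g (+ suc b)) (g -[1+ b ]))))
        (sym (ℤ.neg-distrib-+ (Σ± b g) (g (+ suc b) + g -[1+ b ])))
      x₁ : ∀ k m i → k - (m - ((-1ℤ - i) + (-1ℤ - i))) ≡ k - m - + 2 - (i + i)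
      x₁ = solve-∀
      x₂ : ∀ e t u v i → e - (((-1ℤ - i) * (-1ℤ - i) + (-1ℤ - i) * (-1ℤ - i) + t) + (u + v * (-1ℤ - i))) ≡
                         e - ((i * i + i * i + t) + (u - v + + 2 + (+ 4 - v) * i))
      x₂ = solve-∀
      reflected : ∀ i → f (-1ℤ - i) ≡ - g i
      reflected i = trans
        (cong₂ _*_ (sgn-reflect i) (trans
          (sym (gauss-sym k (m - ((-1ℤ - i) + (-1ℤ - i))) _))
          (cong₂ (gauss k) (x₁ (+ k) m i) (trans
            (cong (λ t → e - (((-1ℤ - i) * (-1ℤ - i) + (-1ℤ - i) * (-1ℤ - i) + t) + (u + v * (-1ℤ - i))))
                  (T-reflect i))
            (x₂ e (T i) u v i)))))
        (sym (ℤ.neg-distribˡ-* (sgn i) _))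

  -- Finite Rogers–Ramanujan identities and positivity

  parity : ∀ k → ∃ λ n → (k ≡ double n) ⊎ (k ≡ suc (double n))
  parity zero = 0 , inj₁ refl
  parity (suc k) with parity k
  ... | n , inj₁ refl = n , inj₂ refl
  ... | n , inj₂ refl = suc n , inj₁ refl

  n≤double : ∀ n → n ℕ.≤ double n
  n≤double zero = ℕ.z≤n
  n≤double (suc n) = ℕ.s≤s (ℕ.m≤n⇒m≤1+n (n≤double n))

  -- ρ n t = Σ_m q^{m² + t m} [n; m], the finite Rogers–Ramanujan sums.
  ρ : ℕ → ℕ → Laurent
  ρ zero    t e = δ 0ℤ e
  ρ (suc n) t e = ρ n t e + ρ n (suc t) (e - + (suc n ℕ.+ t))

  -- The definition of `ρ` encodes one Pascal rule for [n+1; m]; this is the other, [n+1; m] = q^m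
  -- [n; m] + [n; m-1].
  ρ-suc : ∀ n t e → ρ (suc n) t e ≡ ρ n (suc t) e + ρ n (suc (suc t)) (e - + suc t)
  ρ-suc zero    t e = refl
  ρ-suc (suc n) t e = begin
    ρ (suc n) t e + ρ (suc n) (suc t) e′
      ≡⟨ cong₂ _+_ (ρ-suc n t e) (ρ-suc n (suc t) e′) ⟩
    (ρ n (suc t) e + ρ n (suc (suc t)) (e - + suc t)) +
    (ρ n (suc (suc t)) e′ + ρ n (suc (suc (suc t))) (e′ - + suc (suc t)))
      ≡⟨ interchange (ρ n (suc t) e) (ρ n (suc (suc t)) (e - + suc t)) (ρ n (suc (suc t)) e′) _ ⟩
    (ρ n (suc t) e + ρ n (suc (suc t)) e′) +
    (ρ n (suc (suc t)) (e - + suc t) + ρ n (suc (suc (suc t))) (e′ - + suc (suc t)))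
      ≡⟨ cong₂ (λ y z → (ρ n (suc t) e + ρ n (suc (suc t)) y) +
                        (ρ n (suc (suc t)) (e - + suc t) + ρ n (suc (suc (suc t))) z))
           (cong (λ y → e - + suc y) (sym (ℕ.+-suc n t)))
           (trans (x e (+ n) (+ t)) (cong (λ y → e - + suc t - + suc y) (sym (ℕ.+-suc n (suc t))))) ⟩
    ρ (suc n) (suc t) e + ρ (suc n) (suc (suc t)) (e - + suc t) ∎
    where
    open ≡-Reasoning
    e′ = e - + (suc (suc n) ℕ.+ t)
    x : ∀ e n t → e - (1ℤ + (1ℤ + (n + t))) - (1ℤ + (1ℤ + t)) ≡ e - (1ℤ + t) - (1ℤ + (1ℤ + (n + (1ℤ + t))))
    x = solve-∀

  -- Eliminates `ρ n (suc (suc t))` between the two recurrences; at t = 0 it has the shape of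
  -- `S-suc`.
  ρ-suc′ : ∀ n t e → ρ (suc n) (suc t) e ≡
    (ρ n (suc t) e - ρ n (suc t) (e - + suc n)) + ρ (suc n) t (e - + suc n)
  ρ-suc′ n t e = begin
    ρ n (suc t) e + ρ n (suc (suc t)) (e - + (suc n ℕ.+ suc t))
      ≡⟨ cong (λ y → ρ n (suc t) e + ρ n (suc (suc t)) y) (x e (+ n) (+ t)) ⟩
    ρ n (suc t) e + ρ n (suc (suc t)) (e′ - + suc t)
      ≡⟨ cancel (ρ n (suc t) e) (ρ n (suc t) e′) _ ⟩
    (ρ n (suc t) e - ρ n (suc t) e′) + (ρ n (suc t) e′ + ρ n (suc (suc t)) (e′ - + suc t))
      ≡⟨ cong (λ y → (ρ n (suc t) e - ρ n (suc t) e′) + y) (ρ-suc n t e′) ⟨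
    (ρ n (suc t) e - ρ n (suc t) e′) + ρ (suc n) t e′ ∎
    where
    open ≡-Reasoning
    e′ = e - + suc n
    x : ∀ e n t → e - ((1ℤ + n) + (1ℤ + t)) ≡ e - (1ℤ + n) - (1ℤ + t)
    x = solve-∀
    cancel : ∀ a b c → a + c ≡ (a - b) + (b + c)
    cancel = solve-∀

  gauss-neg′ : ∀ k j n y → j ≡ -[1+ n ] → gauss k j y ≡ 0ℤ
  gauss-neg′ k j n y refl = gauss-neg k n y

  gauss-big′ : ∀ k j n y → j ≡ + k + + suc n → gauss k j y ≡ 0ℤ
  gauss-big′ k j n y refl = gauss-big k n y

  x≡-x⇒x≡0 : ∀ x → x ≡ - x → x ≡ 0ℤ
  x≡-x⇒x≡0 (+ 0) eq = refl

  module _ (b : ℕ) where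

    -- Finite forms of the two Rogers-Ramanujan sums, to be matched with Σ q^{m²} [n; m] and Σ
    -- q^{m²+m} [n; m]. Only the first is wanted, but the Pascal recurrences couple the two.
    R S : ℕ → Laurent
    R n = θ b (double n) (+ n) 0ℤ 0ℤ
    S n = θ b (suc (double n)) (+ n) 0ℤ 1ℤ

    -- At i = b the lower entry n - 1 - 2b is negative; at i = -1 - b it is n + 1 + 2b, which
    -- exceeds 2n + 1 ≥ k.
    θ-reflect′ : ∀ k n u v e → n ℕ.< b → k ℕ.≤ suc (double n) →
      θ b k (+ n - 1ℤ) u v e ≡ - θ b k (+ k - (+ n - 1ℤ) - + 2) (u - v + + 2) (+ 4 - v) e
    θ-reflect′ k n u v e n<b k≤
      with d , refl ← ℕ.m≤n⇒∃[o]m+o≡n n<b | d′ , k+d′ ← ℕ.m≤n⇒∃[o]m+o≡n k≤ =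
      θ-reflect b k (+ n - 1ℤ) u v e
        (λ y → gauss-neg′ k _ (2 ℕ.+ (n ℕ.+ d ℕ.+ d)) y (x₁ (+ n) (+ d)))
        (λ y → gauss-big′ k _ (suc (n ℕ.+ d ℕ.+ d ℕ.+ d′)) y (trans
          (x₂ (+ n) (+ d) (+ d′)) (trans
          (cong (λ z → z - + d′ + (1ℤ + (1ℤ + (+ n + + d + + d + + d′)))) 
              (trans (cong (λ z → 1ℤ + z) (sym (+-double n))) (cong +_ (sym k+d′))))
          (x₃ (+ k) (+ d′) _))))
      where
      x₁ : ∀ n d → n - 1ℤ - ((1ℤ + n + d) + (1ℤ + n + d)) ≡ - (1ℤ + (1ℤ + (1ℤ + (n + d + d))))
      x₁ = solve-∀
      x₂ : ∀ n d d′ → n - 1ℤ - (- (1ℤ + (1ℤ + n + d)) + - (1ℤ + (1ℤ + n + d))) ≡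
           (1ℤ + (n + n)) - d′ + (1ℤ + (1ℤ + (n + d + d + d′)))
      x₂ = solve-∀
      x₃ : ∀ k d w → k + d - d + w ≡ k + w
      x₃ = solve-∀

    -- The parameters m = n - 1 and v = 2 are fixed by the reflection i ↦ -1 - i, so the sum equals
    -- its own negative.
    θ-vanishes : ∀ n u e → n ℕ.< b → θ b (double n) (+ n - 1ℤ) u (+ 2) e ≡ 0ℤ
    θ-vanishes n u e n<b = x≡-x⇒x≡0 _ (trans
      (θ-reflect′ (double n) n u (+ 2) e n<b (ℕ.n≤1+n _))
      (cong -_ (θ-cong b (double n) (+ 2) e
        (trans (cong (λ d → d - (+ n - 1ℤ) - + 2) (+-double n)) (x₁ (+ n))) (x₂ u))))
      where
      x₁ : ∀ n → n + n - (n - 1ℤ) - + 2 ≡ n - 1ℤ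
      x₁ = solve-∀
      x₂ : ∀ u → u - + 2 + + 2 ≡ u
      x₂ = solve-∀

    -- The second Pascal term is a self-negative sum. This is why the value of `B k` depends only on
    -- ⌊k/2⌋.
    R-odd : ∀ n e → n ℕ.< b → θ b (suc (double n)) (+ n) 0ℤ 0ℤ e ≡ R n e
    R-odd n e n<b = trans (θ-pascal₁ b (double n) (+ n) 0ℤ 0ℤ e)
      (trans (cong (λ y → R n e + y) (θ-vanishes n (0ℤ + (+ suc (double n) - + n)) e n<b)) (ℤ.+-identityʳ _))

    S-split : ∀ n e → S n e ≡ θ b (double n) (+ n - 1ℤ) 0ℤ 1ℤ e + R n (e - + n)
    S-split n e = trans (θ-pascal₂ b (double n) (+ n) 0ℤ 1ℤ e)
      (cong (λ y → θ b (double n) (+ n - 1ℤ) 0ℤ 1ℤ e + y) (begin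
        θ b (double n) (+ n) (0ℤ + + n) -1ℤ e
          ≡⟨ θ-neg b (double n) (+ n) (+ n) -1ℤ e ⟩
        θ b (double n) (+ double n - + n) (+ n) 0ℤ e
          ≡⟨ θ-cong b (double n) 0ℤ {u = + n} e (trans (cong (_- + n) (+-double n)) (x (+ n))) refl ⟩
        θ b (double n) (+ n) (+ n) 0ℤ e
          ≡⟨ θ-shift b (double n) (+ n) (+ n) 0ℤ e ⟩
        R n (e - + n) ∎))
      where
      open ≡-Reasoning
      x : ∀ n → n + n - n ≡ n
      x = solve-∀

    R-suc : ∀ n e → n ℕ.< b → R (suc n) e ≡ R n e + S n (e - + suc n)
    R-suc n e n<b = begin
      R (suc n) e
        ≡⟨ θ-pascal₁ b (suc (double n)) (+ suc n) 0ℤ 0ℤ e ⟩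
      θ b (suc (double n)) (+ suc n) 0ℤ 0ℤ e + θ b (suc (double n)) (+ n) w (+ 2) e
        ≡⟨ cong₂ _+_ (θ-pascal₂ b (double n) (+ suc n) 0ℤ 0ℤ e) (θ-pascal₂ b (double n) (+ n) w (+ 2) e) ⟩
      (R n e + θ b (double n) (+ suc n) (+ suc n) (- + 2) e) +
      (θ b (double n) (+ n - 1ℤ) w (+ 2) e + θ b (double n) (+ n) (w + + n) 0ℤ e)
        -- Of the four terms the third is self-negative and drops out; the second, after i ↦ -i, and
        -- the fourth are the two halves of `S-split`, both shifted by n + 1.
        ≡⟨ cong₂ (λ y z → (R n e + y) + z) second
             (trans (cong₂ _+_ (θ-vanishes n w e n<b) fourth) (ℤ.+-identityˡ _)) ⟩
      (R n e + θ b (double n) (+ n - 1ℤ) 0ℤ 1ℤ (e - + suc n)) + R n (e - + suc n - + n)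
        ≡⟨ ℤ.+-assoc (R n e) _ _ ⟩
      R n e + (θ b (double n) (+ n - 1ℤ) 0ℤ 1ℤ (e - + suc n) + R n (e - + suc n - + n))
        ≡⟨ cong (λ y → R n e + y) (S-split n (e - + suc n)) ⟨
      R n e + S n (e - + suc n) ∎
      where
      open ≡-Reasoning
      w = 0ℤ + (+ suc (suc (double n)) - + suc n)
      x₁ : ∀ n → n + n - (1ℤ + n) ≡ n - 1ℤ
      x₁ = solve-∀
      second : θ b (double n) (+ suc n) (+ suc n) (- + 2) e ≡ θ b (double n) (+ n - 1ℤ) 0ℤ 1ℤ (e - + suc n)
      second = trans (θ-neg b (double n) (+ suc n) (+ suc n) (- + 2) e)
        (trans (θ-cong b (double n) 1ℤ {u = + suc n} e (trans (cong (_- + suc n) (+-double n)) (x₁ (+ n))) refl)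
               (θ-shift b (double n) (+ n - 1ℤ) (+ suc n) 1ℤ e))
      x₂ : ∀ e n → e - (0ℤ + (1ℤ + (1ℤ + (n + n)) - (1ℤ + n)) + n) ≡ e - (1ℤ + n) - n
      x₂ = solve-∀
      fourth : θ b (double n) (+ n) (w + + n) 0ℤ e ≡ R n (e - + suc n - + n)
      fourth = trans (θ-shift b (double n) (+ n) (w + + n) 0ℤ e)
        (cong (R n) (trans (cong (λ d → e - (0ℤ + (1ℤ + (1ℤ + d) - + suc n) + + n)) (+-double n)) (x₂ e (+ n))))

    S-suc : ∀ n e → n ℕ.< b → S (suc n) e ≡ (S n e - S n (e - + suc n)) + R (suc n) (e - + suc n)
    S-suc n e n<b = trans (S-split (suc n) e) (cong (_+ R (suc n) (e - + suc n)) (begin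
      θ b (suc (suc (double n))) (+ n) 0ℤ 1ℤ e
        ≡⟨ θ-pascal₁ b (suc (double n)) (+ n) 0ℤ 1ℤ e ⟩
      S n e + θ b (suc (double n)) (+ n - 1ℤ) w (+ 3) e
        -- Reflection turns v = 3 into v = 1 and reproduces S n with a minus sign: the origin of the
        -- factor 1 - q^{n+1}.
        ≡⟨ cong (λ y → S n e + y) (θ-reflect′ (suc (double n)) n w (+ 3) e n<b ℕ.≤-refl) ⟩
      S n e - θ b (suc (double n)) (+ suc (double n) - (+ n - 1ℤ) - + 2) (w - + 3 + + 2) 1ℤ e
        ≡⟨ cong (λ y → S n e - y) (trans
             (θ-cong b (suc (double n)) 1ℤ e
               (trans (cong (λ d → 1ℤ + d - (+ n - 1ℤ) - + 2) (+-double n)) (x₁ (+ n)))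
               (trans (cong (λ d → 0ℤ + (1ℤ + (1ℤ + d) - + n) - + 3 + + 2) (+-double n)) (x₂ (+ n))))
             (θ-shift b (suc (double n)) (+ n) (+ suc n) 1ℤ e)) ⟩
      S n e - S n (e - + suc n) ∎))
      where
      open ≡-Reasoning
      w = 0ℤ + (+ suc (suc (double n)) - + n)
      x₁ : ∀ n → 1ℤ + (n + n) - (n - 1ℤ) - + 2 ≡ n
      x₁ = solve-∀
      x₂ : ∀ n → 0ℤ + (1ℤ + (1ℤ + (n + n)) - n) - + 3 + + 2 ≡ 1ℤ + n
      x₂ = solve-∀

    R-0 : ∀ e → R 0 e ≡ δ 0ℤ e
    R-0 e = trans (Σ±-single b
      (λ n → ℤ.*-zeroʳ (sgn (+ suc n)))
      (λ n → ℤ.*-zeroʳ (sgn -[1+ n ])))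
      (trans (ℤ.*-identityˡ _) (cong (δ 0ℤ) (ℤ.+-identityʳ e)))

    S-0 : ∀ e → S 0 e ≡ δ 0ℤ e
    S-0 e = trans (S-split 0 e) (trans
      (cong₂ _+_ (Σ±-zero b vanish) (trans (R-0 (e - 0ℤ)) (cong (δ 0ℤ) (ℤ.+-identityʳ e))))
      (ℤ.+-identityˡ _))
      where
      vanish : ∀ i → sgn i * δ (-1ℤ - (i + i)) (e - (κ i + (0ℤ + 1ℤ * i))) ≡ 0ℤ
      vanish (+ 0) = refl
      vanish (+ suc n) = ℤ.*-zeroʳ (sgn (+ suc n))
      vanish -[1+ n ] = ℤ.*-zeroʳ (sgn -[1+ n ])

    R-S-ρ : ∀ n → n ℕ.≤ b → (∀ e → R n e ≡ ρ n 0 e) × (∀ e → S n e ≡ ρ n 1 e)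
    R-S-ρ zero    _   = R-0 , S-0
    R-S-ρ (suc n) n<b = R≡ , S≡
      where
      ih = R-S-ρ n (ℕ.<⇒≤ n<b)
      R≡ : ∀ e → R (suc n) e ≡ ρ (suc n) 0 e
      R≡ e = trans (R-suc n e n<b) (cong₂ _+_ (proj₁ ih e)
        (trans (proj₂ ih (e - + suc n)) (cong (λ k → ρ n 1 (e - + suc k)) (sym (ℕ.+-identityʳ n)))))
      S≡ : ∀ e → S (suc n) e ≡ ρ (suc n) 1 e
      S≡ e = trans (S-suc n e n<b) (trans
        (cong₂ _+_ (cong₂ _-_ (proj₂ ih e) (proj₂ ih (e - + suc n))) (R≡ (e - + suc n)))
        (sym (ρ-suc′ n 0 e)))

    -- The case K = 2 of the sums G, with exponents κ; by Bressoud's finite form of the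
    -- Rogers–Ramanujan identities it is ρ ⌊k/2⌋ 0.
    B : ℕ → Laurent
    B k e = Σ± b (λ i → sgn i * H k (+ 4 * i) (e - κ i))

    B≡θ : ∀ k n e → (∀ i → half (+ k - + 4 * i) ≡ + n - (i + i)) → B k e ≡ θ b k (+ n) 0ℤ 0ℤ e
    B≡θ k n e h = Σ±-cong b λ i → cong (sgn i *_) (cong₂ (gauss k) (h i) (x e (κ i) i))
      where
      x : ∀ e t i → e - t ≡ e - (t + (0ℤ + 0ℤ * i))
      x = solve-∀

    B≡ρ : ∀ k → k ℕ.< b → ∃ λ n → ∀ e → B k e ≡ ρ n 0 e
    B≡ρ k k<b with parity k
    ... | n , inj₁ refl = n , λ e → trans
      (B≡θ (double n) n e (λ i → trans
        (cong half (trans (cong (_- + 4 * i) (+-double n)) (x (+ n) i)))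
        (half-double (+ n - (i + i)))))
      (proj₁ (R-S-ρ n (ℕ.≤-trans (n≤double n) (ℕ.<⇒≤ k<b))) e)
      where
      x : ∀ n i → n + n - + 4 * i ≡ (n - (i + i)) + (n - (i + i))
      x = solve-∀
    ... | n , inj₂ refl = n , λ e → trans
      (B≡θ (suc (double n)) n e (λ i → trans
        (cong half (trans (cong (λ d → 1ℤ + d - + 4 * i) (+-double n)) (x (+ n) i)))
        (half-1+double (+ n - (i + i)))))
      (trans (R-odd n e n<b) (proj₁ (R-S-ρ n (ℕ.<⇒≤ n<b)) e))
      where
      n<b : n ℕ.< b
      n<b = ℕ.<-trans (ℕ.s≤s (n≤double n)) k<b
      x : ∀ n i → 1ℤ + (n + n) - + 4 * i ≡ 1ℤ + ((n - (i + i)) + (n - (i + i)))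
      x = solve-∀

    P-sum : ∀ L e → Σ± b (λ i → sgn i * P L (+ 4 * i) (e - κ i)) ≡ ⟦ Ψ L ⟧ (λ s → ⟦ W s ⟧ B) e
    P-sum L e = begin
      Σ± b (λ i → sgn i * P L (+ 4 * i) (e - κ i))
        ≡⟨ Σ±-cong b (λ i → cong (sgn i *_) (P-expansion L (+ 4 * i) (e - κ i))) ⟩
      Σ± b (λ i → sgn i * ⟦ Ψ L ⟧ (λ s → ⟦ W s ⟧ (Hᵢ i)) (e - κ i))
        ≡⟨ ⟦⟧-Σ± (Ψ L) b sgn κ (λ i s → ⟦ W s ⟧ (Hᵢ i)) e ⟨
      ⟦ Ψ L ⟧ (λ s e → Σ± b (λ i → sgn i * ⟦ W s ⟧ (Hᵢ i) (e - κ i))) e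
        ≡⟨ ⟦⟧-cong (Ψ L) (λ s e → sym (⟦⟧-Σ± (W s) b sgn κ Hᵢ e)) e ⟩
      ⟦ Ψ L ⟧ (λ s → ⟦ W s ⟧ B) e ∎
      where
      open ≡-Reasoning
      Hᵢ : ℤ → ℕ → Laurent
      Hᵢ i k = H k (+ 4 * i)

  -- Closure properties of nonnegative polynomials

  ι : Series → Laurent
  ι f (+ n)    = f n
  ι f -[1+ n ] = 0ℤ

  NonNeg : Laurent → Set
  NonNeg f = ∃ λ cs → ∀ e → f e ≡ ι (polynomial cs) e

  NonNeg-resp : ∀ {f g} → (∀ e → f e ≡ g e) → NonNeg g → NonNeg f
  NonNeg-resp f≗g (cs , h) = cs , λ e → trans (f≗g e) (h e)

  NonNeg-δ : NonNeg (δ 0ℤ)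
  NonNeg-δ = 1 ∷ [] , λ { (+ 0) → refl ; (+ suc n) → refl ; -[1+ n ] → refl }

  add : List ℕ → List ℕ → List ℕ
  add []       ds       = ds
  add (c ∷ cs) []       = c ∷ cs
  add (c ∷ cs) (d ∷ ds) = c ℕ.+ d ∷ add cs ds

  polynomial-add : ∀ cs ds n → polynomial (add cs ds) n ≡ polynomial cs n + polynomial ds n
  polynomial-add []       ds       n       = sym (ℤ.+-identityˡ _)
  polynomial-add (c ∷ cs) []       n       = sym (ℤ.+-identityʳ _)
  polynomial-add (c ∷ cs) (d ∷ ds) zero    = refl
  polynomial-add (c ∷ cs) (d ∷ ds) (suc n) = polynomial-add cs ds n

  NonNeg-+ : ∀ {f g} → NonNeg f → NonNeg g → NonNeg (λ e → f e + g e)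
  NonNeg-+ (cs , p) (ds , q) = add cs ds , λ
    { (+ n)    → trans (cong₂ _+_ (p (+ n)) (q (+ n))) (sym (polynomial-add cs ds n))
    ; -[1+ n ] → cong₂ _+_ (p -[1+ n ]) (q -[1+ n ]) }

  NonNeg-shift : ∀ a {f} → NonNeg f → NonNeg (λ e → f (e - + a))
  NonNeg-shift zero    {f} p = NonNeg-resp (λ e → cong f (ℤ.+-identityʳ e)) p
  NonNeg-shift (suc a) {f} p with ds , q ← NonNeg-shift a {f} p = 0 ∷ ds , λ e →
    trans (cong f (x e (+ a))) (trans (q (e - 1ℤ)) (cons e))
    where
    x : ∀ e a → e - (1ℤ + a) ≡ e - 1ℤ - a
    x = solve-∀
    cons : ∀ e → ι (polynomial ds) (e - 1ℤ) ≡ ι (polynomial (0 ∷ ds)) e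
    cons (+ 0) = refl
    cons (+ suc n) = refl
    cons -[1+ n ] = refl

  NonNeg-ρ : ∀ n t → NonNeg (ρ n t)
  NonNeg-ρ zero    t = NonNeg-δ
  NonNeg-ρ (suc n) t = NonNeg-+ (NonNeg-ρ n t) (NonNeg-shift (suc n ℕ.+ t) (NonNeg-ρ n (suc t)))

  -- Nonnegativity is demanded only for k ≤ s, since `B≡ρ` identifies `B k` only for k below the
  -- window size.
  NonNeg-W : ∀ s {f} → (∀ k → k ℕ.≤ s → NonNeg (f k)) → NonNeg (⟦ W s ⟧ f)
  NonNeg-W zero    {f} p = NonNeg-resp (⟦⟧-one f) (p 0 ℕ.z≤n)
  NonNeg-W (suc s) {f} p = NonNeg-resp (W-suc s f) (NonNeg-+
    (NonNeg-W s (λ k k≤s → p (suc k) (ℕ.s≤s k≤s)))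
    (NonNeg-shift (suc s) (NonNeg-W s (λ k k≤s → p k (ℕ.m≤n⇒m≤1+n k≤s)))))

  NonNeg-Ψ : ∀ L {w} → (∀ s → s ℕ.≤ L → NonNeg (w s)) → NonNeg (⟦ Ψ L ⟧ w)
  NonNeg-Ψ zero    {w} p = NonNeg-resp (⟦⟧-one w) (p 0 ℕ.z≤n)
  NonNeg-Ψ (suc L) {w} p = NonNeg-resp (Ψ-suc L w) (NonNeg-+
    (NonNeg-Ψ L (λ s s≤L → p s (ℕ.m≤n⇒m≤1+n s≤L)))
    (NonNeg-shift (suc L) (NonNeg-Ψ L (λ s s≤L → p (suc s) (ℕ.s≤s s≤L)))))

  P-sum-NonNeg : ∀ L b → L ℕ.< b → NonNeg (λ e → Σ± b (λ i → sgn i * P L (+ 4 * i) (e - κ i)))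
  P-sum-NonNeg L b L<b = NonNeg-resp (P-sum b L) (NonNeg-Ψ L λ s s≤L → NonNeg-W s λ k k≤s →
    let n , B≡ = B≡ρ b k (ℕ.≤-<-trans (ℕ.≤-trans k≤s s≤L) L<b)
    in NonNeg-resp B≡ (NonNeg-ρ n 0))

  -- Comparison with the q-binomial quotients

  -- Replaces a claim about a long division by a product identity, which for binomials is `gauss-D`.
  ⊘-unique : ∀ f g h → g 0 ≡ 1ℤ → (∀ n → (h ⊗ g) n ≡ f n) → ∀ n → (f ⊘ g) n ≡ h n
  ⊘-unique f g h g₀ eq zero = trans (sym (eq 0)) (trans (cong (h 0 *_) g₀) (ℤ.*-identityʳ (h 0)))
  ⊘-unique f g h g₀ eq (suc n) = ⊘-unique (tail f ⊖ f 0 ⊙ tail g) g (tail h) g₀ step n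
    where
    cancel : ∀ a b → b ≡ (a + b) - a
    cancel = solve-∀
    step : ∀ n → (tail h ⊗ g) n ≡ f (suc n) - f 0 * g (suc n)
    step n = trans (cancel (h 0 * g (suc n)) _) (cong₂ (λ x y → x - y * g (suc n)) (eq (suc n))
      (trans (sym (trans (cong (h 0 *_) g₀) (ℤ.*-identityʳ (h 0)))) (eq 0)))

  -- Σ_{i ≤ N} f i γ(e - i): unlike in f ⊗ g, the bound N does not depend on the degree e
  -- and so survives a shift of γ.
  conv : ℕ → Series → Laurent → Laurent
  conv zero    f γ e = f 0 * γ e
  conv (suc N) f γ e = f 0 * γ e + conv N (tail f) γ (e - 1ℤ)

  conv-neg : ∀ N f g n → conv N f (ι g) -[1+ n ] ≡ 0ℤ
  conv-neg zero    f g n = ℤ.*-zeroʳ (f 0)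
  conv-neg (suc N) f g n = cong₂ _+_ (ℤ.*-zeroʳ (f 0)) (conv-neg N (tail f) g (suc (n ℕ.+ 0)))

  ι-⊗ : ∀ N f g n → n ℕ.≤ N → (f ⊗ g) n ≡ conv N f (ι g) (+ n)
  ι-⊗ zero    f g zero    _ = refl
  ι-⊗ (suc N) f g zero    _ = sym (trans (cong (λ x → f 0 * g 0 + x) (conv-neg N (tail f) g 0)) (ℤ.+-identityʳ _))
  ι-⊗ (suc N) f g (suc n) (ℕ.s≤s n≤N) = cong (λ x → f 0 * g (suc n) + x) (ι-⊗ N (tail f) g n n≤N)

  ι-⊗′ : ∀ N f g e → (∀ {n} → e ≡ + n → n ℕ.≤ N) → ι (f ⊗ g) e ≡ conv N f (ι g) e
  ι-⊗′ N f g (+ n)    h = ι-⊗ N f g n (h refl)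
  ι-⊗′ N f g -[1+ n ] h = sym (conv-neg N f g n)

  conv-minus : ∀ N f {γ γ₁ γ₂ : Laurent} → (∀ e → γ e ≡ γ₁ e - γ₂ e) → ∀ e →
    conv N f γ e ≡ conv N f γ₁ e - conv N f γ₂ e
  conv-minus zero    f {γ} {γ₁} {γ₂} h e = trans (cong (f 0 *_) (h e)) (x (f 0) (γ₁ e) (γ₂ e))
    where
    x : ∀ c a b → c * (a - b) ≡ c * a - c * b
    x = solve-∀
  conv-minus (suc N) f {γ} {γ₁} {γ₂} h e =
    trans (cong₂ (λ y z → f 0 * y + z) (h e) (conv-minus N (tail f) h (e - 1ℤ)))
      (x (f 0) (γ₁ e) (γ₂ e) (conv N (tail f) γ₁ (e - 1ℤ)) (conv N (tail f) γ₂ (e - 1ℤ)))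
    where
    x : ∀ c a b d d′ → c * (a - b) + (d - d′) ≡ (c * a + d) - (c * b + d′)
    x = solve-∀

  conv-shift : ∀ N f γ a e → conv N f (λ e → γ (e - a)) e ≡ conv N f γ (e - a)
  conv-shift zero    f γ a e = refl
  conv-shift (suc N) f γ a e = cong (λ y → f 0 * γ (e - a) + y)
    (trans (conv-shift N (tail f) γ a (e - 1ℤ)) (cong (conv N (tail f) γ) (minus-comm e 1ℤ a)))

  -- A factor 1 - q^s can be pulled out of the right argument of `⊗`. Since (q)_m is built from such
  -- factors, this stands in for associativity of the product.
  ⊗-minus-shift : ∀ f {g g′} s → (∀ e → ι g′ e ≡ ι g e - ι g (e - + s)) →
    ∀ e → ι (f ⊗ g′) e ≡ ι (f ⊗ g) e - ι (f ⊗ g) (e - + s)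
  ⊗-minus-shift f {g} {g′} s h e = begin
    ι (f ⊗ g′) e
      ≡⟨ ι-⊗′ N f g′ e (λ {e≡ → ℕ.≤-reflexive (cong ∣_∣ (sym e≡))}) ⟩
    conv N f (ι g′) e
      ≡⟨ conv-minus N f h e ⟩
    conv N f (ι g) e - conv N f (λ e → ι g (e - + s)) e
      ≡⟨ cong (λ y → conv N f (ι g) e - y) (conv-shift N f (ι g) (+ s) e) ⟩
    conv N f (ι g) e - conv N f (ι g) (e - + s)
      ≡⟨ cong₂ _-_ (ι-⊗′ N f g e (λ {e≡ → ℕ.≤-reflexive (cong ∣_∣ (sym e≡))})) (ι-⊗′ N f g (e - + s) (bound e)) ⟨
    ι (f ⊗ g) e - ι (f ⊗ g) (e - + s) ∎
    where
    open ≡-Reasoning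
    -- One bound has to serve at e and at e - s; whenever e - s is a natural number it is at most ∣
    -- e ∣.
    N = ∣ e ∣
    x : ∀ e s → e ≡ e - s + s
    x = solve-∀
    bound : ∀ e {n} → e - + s ≡ + n → n ℕ.≤ ∣ e ∣
    bound e {n} eq = ℕ.≤-trans (ℕ.m≤m+n n s) (ℕ.≤-reflexive (cong ∣_∣ (sym (trans (x e (+ s)) (cong (_+ + s) eq)))))

  q^-δ : ∀ j n → (q^ j) n ≡ δ 0ℤ (n ℤ.⊖ j)
  q^-δ zero    zero    = refl
  q^-δ zero    (suc n) = refl
  q^-δ (suc j) zero    = refl
  q^-δ (suc j) (suc n) = trans (q^-δ j n) (cong (δ 0ℤ) (sym (ℤ.[1+m]⊖[1+n]≡m⊖n n j)))

  ι-q^ : ∀ j e → ι (q^ j) e ≡ δ 0ℤ (e - + j)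
  ι-q^ j       (+ n)    = trans (q^-δ j n) (cong (δ 0ℤ) (sym (ℤ.m-n≡m⊖n n j)))
  ι-q^ zero    -[1+ n ] = refl
  ι-q^ (suc j) -[1+ n ] = refl

  ι-q⁰ : ∀ e → ι (q^ 0) e ≡ δ 0ℤ e
  ι-q⁰ e = trans (ι-q^ 0 e) (cong (δ 0ℤ) (ℤ.+-identityʳ e))

  ⊗-identityʳ : ∀ f n → (f ⊗ (q^ 0)) n ≡ f n
  ⊗-identityʳ f zero    = ℤ.*-identityʳ (f 0)
  ⊗-identityʳ f (suc n) = trans (cong₂ _+_ (ℤ.*-zeroʳ (f 0)) (⊗-identityʳ (tail f) n)) (ℤ.+-identityˡ _)

  ι-cong : ∀ {f g} → (∀ n → f n ≡ g n) → ∀ e → ι f e ≡ ι g e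
  ι-cong f≗g (+ n)    = f≗g n
  ι-cong f≗g -[1+ n ] = refl

  ⊗-1-q^ : ∀ f s e → ι (f ⊗ (q^ 0 ⊖ q^ suc s)) e ≡ ι f e - ι f (e - + suc s)
  ⊗-1-q^ f s e = trans
    (⊗-minus-shift f (suc s) factor e)
    (cong₂ _-_ (ι-cong (⊗-identityʳ f) e) (ι-cong (⊗-identityʳ f) (e - + suc s)))
    where
    ι-minus : ∀ (f g : Series) e → ι (f ⊖ g) e ≡ ι f e - ι g e
    ι-minus f g (+ n)    = refl
    ι-minus f g -[1+ n ] = refl
    factor : ∀ e → ι (q^ 0 ⊖ q^ suc s) e ≡ ι (q^ 0) e - ι (q^ 0) (e - + suc s)
    factor e = trans (ι-minus (q^ 0) (q^ suc s) e)
      (cong (λ y → ι (q^ 0) e - y) (trans (ι-q^ (suc s) e) (sym (ι-q⁰ (e - + suc s)))))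

  -- Multiplication by (q)_m.
  D : ℕ → Laurent → Laurent
  D zero    f e = f e
  D (suc m) f e = D m f e - D m f (e - + suc m)

  D-cong : ∀ m {f g} → (∀ e → f e ≡ g e) → ∀ e → D m f e ≡ D m g e
  D-cong zero    f≗g e = f≗g e
  D-cong (suc m) f≗g e = cong₂ _-_ (D-cong m f≗g e) (D-cong m f≗g (e - + suc m))

  D-+ : ∀ m f g e → D m (λ e → f e + g e) e ≡ D m f e + D m g e
  D-+ zero    f g e = refl
  D-+ (suc m) f g e = trans (cong₂ _-_ (D-+ m f g e) (D-+ m f g e′)) (x (D m f e) (D m g e) (D m f e′) (D m g e′))
    where
    e′ = e - + suc m
    x : ∀ a b c d → (a + b) - (c + d) ≡ (a - c) + (b - d)
    x = solve-∀

  D-neg : ∀ m f e → D m (λ e → - f e) e ≡ - D m f e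
  D-neg zero    f e = refl
  D-neg (suc m) f e = trans (cong₂ _-_ (D-neg m f e) (D-neg m f (e - + suc m)))
    (sym (ℤ.neg-distrib-+ (D m f e) (- D m f (e - + suc m))))

  D-shift : ∀ m f a e → D m (λ e → f (e - a)) e ≡ D m f (e - a)
  D-shift zero    f a e = refl
  D-shift (suc m) f a e = cong₂ _-_ (D-shift m f a e)
    (trans (D-shift m f a (e - + suc m)) (cong (D m f) (minus-comm e (+ suc m) a)))

  D-comm : ∀ m n f e → D m (D n f) e ≡ D n (D m f) e
  D-comm m zero    f e = refl
  D-comm m (suc n) f e = begin
    D m (λ e → D n f e - D n f (e - + suc n)) e
      ≡⟨ D-+ m (D n f) (λ e → - D n f (e - + suc n)) e ⟩
    D m (D n f) e + D m (λ e → - D n f (e - + suc n)) e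
      ≡⟨ cong (λ y → D m (D n f) e + y) (trans (D-neg m (λ e → D n f (e - + suc n)) e)
           (cong -_ (D-shift m (D n f) (+ suc n) e))) ⟩
    D m (D n f) e - D m (D n f) (e - + suc n)
      ≡⟨ cong₂ _-_ (D-comm m n f e) (D-comm m n f (e - + suc n)) ⟩
    D n (D m f) e - D n (D m f) (e - + suc n) ∎
    where open ≡-Reasoning

  ⟨q⟩-D : ∀ m e → ι (⟨q⟩ m) e ≡ D m (δ 0ℤ) e
  ⟨q⟩-D zero    e = ι-q⁰ e
  ⟨q⟩-D (suc m) e = trans (⊗-1-q^ (⟨q⟩ m) m e) (cong₂ _-_ (⟨q⟩-D m e) (⟨q⟩-D m (e - + suc m)))

  ⊗-⟨q⟩ : ∀ f m e → ι (f ⊗ (⟨q⟩ m)) e ≡ D m (ι f) e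
  ⊗-⟨q⟩ f zero    e = ι-cong (⊗-identityʳ f) e
  ⊗-⟨q⟩ f (suc m) e = trans (⊗-minus-shift f (suc m) (⊗-1-q^ (⟨q⟩ m) m) e)
    (cong₂ _-_ (⊗-⟨q⟩ f m e) (⊗-⟨q⟩ f m (e - + suc m)))

  ⊗-congʳ : ∀ f {g h} → (∀ n → g n ≡ h n) → ∀ n → (f ⊗ g) n ≡ (f ⊗ h) n
  ⊗-congʳ f g≗h zero    = cong (f 0 *_) (g≗h 0)
  ⊗-congʳ f g≗h (suc n) = cong₂ (λ x y → f 0 * x + y) (g≗h (suc n)) (⊗-congʳ (tail f) g≗h n)

  ⊗-⟨q⟩-⟨q⟩ : ∀ f m n e → ι (f ⊗ ((⟨q⟩ m) ⊗ (⟨q⟩ n))) e ≡ D n (D m (ι f)) e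
  ⊗-⟨q⟩-⟨q⟩ f m zero    e = trans (ι-cong (⊗-congʳ f (⊗-identityʳ (⟨q⟩ m))) e) (⊗-⟨q⟩ f m e)
  ⊗-⟨q⟩-⟨q⟩ f m (suc n) e = trans
    (⊗-minus-shift f (suc n) (⊗-minus-shift (⟨q⟩ m) (suc n) (⊗-1-q^ (⟨q⟩ n) n)) e)
    (cong₂ _-_ (⊗-⟨q⟩-⟨q⟩ f m n e) (⊗-⟨q⟩-⟨q⟩ f m n (e - + suc n)))

  -- This is (q)_m (q)_n [m+n; m] = (q)_{m+n}. The induction step combines Pascal's rule with (1 -
  -- q^{n+1}) + q^{n+1} (1 - q^{m+1}) = 1 - q^{m+n+2}.
  gauss-D : ∀ m n e → D n (D m (gauss (m ℕ.+ n) (+ m))) e ≡ D (m ℕ.+ n) (δ 0ℤ) e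
  gauss-D zero    n e = D-cong n (gauss-0 n) e
  gauss-D (suc m) zero e rewrite ℕ.+-identityʳ m = D-cong (suc m) (gauss-full (suc m)) e
  gauss-D (suc m) (suc n) e = begin
    D (suc n) (D (suc m) (gauss (suc k) (+ suc m))) e
      ≡⟨ D-cong (suc n) (D-cong (suc m) split) e ⟩
    D (suc n) (D (suc m) (λ e → A e + B′ (e - + suc n))) e
      ≡⟨ D-cong (suc n) (λ e → trans (D-+ (suc m) A (λ e → B′ (e - + suc n)) e)
           (cong (λ y → D (suc m) A e + y) (D-shift (suc m) B′ (+ suc n) e))) e ⟩
    D (suc n) (λ e → D (suc m) A e + D (suc m) B′ (e - + suc n)) e
      ≡⟨ trans (D-+ (suc n) (D (suc m) A) (λ e → D (suc m) B′ (e - + suc n)) e)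
           (cong (λ y → D (suc n) (D (suc m) A) e + y) (D-shift (suc n) (D (suc m) B′) (+ suc n) e)) ⟩
    (D n (D (suc m) A) e - D n (D (suc m) A) (e - + suc n)) + D (suc n) (D (suc m) B′) (e - + suc n)
      ≡⟨ cong₂ _+_ (cong₂ _-_ (partA e) (partA (e - + suc n)))
           (trans (D-comm (suc n) (suc m) B′ (e - + suc n))
             (cong₂ _-_ (partB (e - + suc n)) (partB (e - + suc n - + suc m)))) ⟩
    (E e - E (e - + suc n)) + (E (e - + suc n) - E (e - + suc n - + suc m))
      ≡⟨ cancel (E e) (E (e - + suc n)) _ ⟩
    E e - E (e - + suc n - + suc m)
      ≡⟨ cong (λ y → E e - E y) (x₂ e (+ m) (+ n)) ⟩
    E e - E (e - + suc k) ∎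
    where
    open ≡-Reasoning
    k = m ℕ.+ suc n
    A = gauss k (+ suc m)
    B′ = gauss k (+ m)
    E = D k (δ 0ℤ)
    cancel : ∀ a b c → (a - b) + (b - c) ≡ a - c
    cancel = solve-∀
    x₁ : ∀ e m n → e - (1ℤ + (m + (1ℤ + n)) - (1ℤ + m)) ≡ e - (1ℤ + n)
    x₁ = solve-∀
    x₂ : ∀ e m n → e - (1ℤ + n) - (1ℤ + m) ≡ e - (1ℤ + (m + (1ℤ + n)))
    x₂ = solve-∀
    split : ∀ e → gauss (suc k) (+ suc m) e ≡ A e + B′ (e - + suc n)
    split e = cong (λ y → A e + B′ y) (x₁ e (+ m) (+ n))
    partA : ∀ e → D n (D (suc m) A) e ≡ E e
    partA e rewrite ℕ.+-suc m n = gauss-D (suc m) n e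
    partB : ∀ e → D m (D (suc n) B′) e ≡ E e
    partB e = trans (D-comm m (suc n) B′ e) (gauss-D m (suc n) e)

  qBinomial-def : ∀ m n → qBinomial (+ (m ℕ.+ n)) (+ m) ≡ ⟨q⟩ (m ℕ.+ n) ⊘ ((⟨q⟩ m) ⊗ (⟨q⟩ n))
  qBinomial-def m n
    rewrite trans (ℤ.m-n≡m⊖n (m ℕ.+ n) m)
           (trans (ℤ.⊖-≥ (ℕ.m≤m+n m n)) (cong +_ (ℕ.m+n∸m≡n m n))) = refl

  gaussSeries : ℕ → ℤ → Series
  gaussSeries k j n = gauss k j (+ n)

  ι-gauss : ∀ k j e → ι (gaussSeries k j) e ≡ gauss k j e
  ι-gauss k j (+ n)    = refl
  ι-gauss k j -[1+ n ] = sym (gauss-neg-exp k j n)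

  ι-qBinomial : ∀ N j e → ι (qBinomial (+ N) j) e ≡ gauss N j e
  ι-qBinomial N j -[1+ n ] = sym (gauss-neg-exp N j n)
  ι-qBinomial N -[1+ m ] (+ n) = sym (gauss-neg N m (+ n))
  ι-qBinomial N (+ m) (+ n) with ℕ.≤-<-connex m N
  ... | inj₁ m≤N with r , refl ← ℕ.m≤n⇒∃[o]m+o≡n m≤N =
    trans (cong (λ f → f n) (qBinomial-def m r))
      (⊘-unique (⟨q⟩ (m ℕ.+ r)) ((⟨q⟩ m) ⊗ (⟨q⟩ r)) (gaussSeries (m ℕ.+ r) (+ m))
        (cong₂ _*_ (⟨q⟩-const m) (⟨q⟩-const r)) quotient n)
    where
    quotient : ∀ n → (gaussSeries (m ℕ.+ r) (+ m) ⊗ ((⟨q⟩ m) ⊗ (⟨q⟩ r))) n ≡ (⟨q⟩ (m ℕ.+ r)) n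
    quotient n = trans (⊗-⟨q⟩-⟨q⟩ (gaussSeries (m ℕ.+ r) (+ m)) m r (+ n))
      (trans (D-cong r (D-cong m (ι-gauss (m ℕ.+ r) (+ m))) (+ n))
        (trans (gauss-D m r (+ n)) (sym (⟨q⟩-D (m ℕ.+ r) (+ n)))))
  ... | inj₂ N<m with d , refl ← ℕ.m≤n⇒∃[o]m+o≡n N<m = trans
    (qBinomial-big (+ N) (+ (suc N ℕ.+ d)) (subst (ℤ._< 0ℤ) (sym (x (+ N) (+ d))) ℤ.-<+) n)
    (sym (trans (cong (λ i → gauss N i (+ n)) (x′ (+ N) (+ d))) (gauss-big N d (+ n))))
    where
    x : ∀ N d → N - (1ℤ + (N + d)) ≡ - (1ℤ + d)
    x = solve-∀
    x′ : ∀ N d → 1ℤ + (N + d) ≡ N + (1ℤ + d)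
    x′ = solve-∀

  -- Rational exponents

  fromℤ-+ : ∀ a b → fromℤ (a + b) ≡ fromℤ a ℚ.+ fromℤ b
  fromℤ-+ a b = ℚ.toℚᵘ-injective (begin-equality
    toℚᵘ (fromℤ (a + b))                ≃⟨ ℚ.toℚᵘ-fromℚᵘ (mkℚᵘ (a + b) 0) ⟩
    mkℚᵘ (a + b) 0                      ≃⟨ *≡* (x a b) ⟩
    mkℚᵘ a 0 ℚᵘ.+ mkℚᵘ b 0              ≃⟨ ℚᵘ.+-cong (ℚ.toℚᵘ-fromℚᵘ (mkℚᵘ a 0)) (ℚ.toℚᵘ-fromℚᵘ (mkℚᵘ b 0)) ⟨
    toℚᵘ (fromℤ a) ℚᵘ.+ toℚᵘ (fromℤ b)  ≃⟨ ℚ.toℚᵘ-homo-+ (fromℤ a) (fromℤ b) ⟨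
    toℚᵘ (fromℤ a ℚ.+ fromℤ b)          ∎)
    where
    open ℚᵘ.≤-Reasoning
    x : ∀ a b → (a + b) * 1ℤ ≡ (a * 1ℤ + b * 1ℤ) * 1ℤ
    x = solve-∀

  fromℤ-* : ∀ a b → fromℤ (a * b) ≡ fromℤ a ℚ.* fromℤ b
  fromℤ-* a b = ℚ.toℚᵘ-injective (begin-equality
    toℚᵘ (fromℤ (a * b))                ≃⟨ ℚ.toℚᵘ-fromℚᵘ (mkℚᵘ (a * b) 0) ⟩
    mkℚᵘ (a * b) 0                      ≃⟨ *≡* refl ⟩
    mkℚᵘ a 0 ℚᵘ.* mkℚᵘ b 0              ≃⟨ ℚᵘ.*-cong (ℚ.toℚᵘ-fromℚᵘ (mkℚᵘ a 0)) (ℚ.toℚᵘ-fromℚᵘ (mkℚᵘ b 0)) ⟨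
    toℚᵘ (fromℤ a) ℚᵘ.* toℚᵘ (fromℤ b)  ≃⟨ ℚ.toℚᵘ-homo-* (fromℤ a) (fromℤ b) ⟨
    toℚᵘ (fromℤ a ℚ.* fromℤ b)          ∎)
    where open ℚᵘ.≤-Reasoning

  fromℤ-minus : ∀ a b → fromℤ a ℚ.- fromℤ b ≡ fromℤ (a - b)
  fromℤ-minus a b = trans
    (cong (λ c → fromℤ c ℚ.- fromℤ b) (x a b))
    (trans (cong (ℚ._- fromℤ b) (fromℤ-+ (a - b) b)) (y (fromℤ (a - b)) (fromℤ b)))
    where
    x : ∀ a b → a ≡ a - b + b
    x = solve-∀
    open Data.Rational.Solver.+-*-Solver
    y : ∀ p r → p ℚ.+ r ℚ.- r ≡ p
    y = solve 2 (λ p r → p :+ r :- r := p) refl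

  fromℤ≡mkℚ : ∀ y → fromℤ y ≡ mkℚ y 0 (Coprimality.sym (1-coprimeTo ∣ y ∣))
  fromℤ≡mkℚ y = ℚ.↥p/↧p≡p (mkℚ y 0 (Coprimality.sym (1-coprimeTo ∣ y ∣)))

  integer? : ∀ e → (∃ λ z → e ≡ fromℤ z) ⊎ (∀ z → e ≢ fromℤ z)
  integer? (mkℚ n zero    c) = inj₁ (n , sym (fromℤ≡mkℚ n))
  integer? (mkℚ n (suc d) c) = inj₂ λ z eq → contradiction (trans eq (fromℤ≡mkℚ z)) λ ()

  shift-integral : ∀ r f e y → e ℚ.- r ≡ fromℤ y → shift r f e ≡ ι f y
  shift-integral r f e (+ n) eq with e ℚ.- r | trans eq (fromℤ≡mkℚ (+ n))
  ... | _ | refl = refl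
  shift-integral r f e -[1+ n ] eq with e ℚ.- r | trans eq (fromℤ≡mkℚ -[1+ n ])
  ... | _ | refl = refl

  shift-fractional : ∀ r f e → (∀ y → e ℚ.- r ≢ fromℤ y) → shift r f e ≡ 0ℤ
  shift-fractional r f e ne with e ℚ.- r
  ... | mkℚ (+ n)    zero    c = contradiction (sym (fromℤ≡mkℚ (+ n))) (ne (+ n))
  ... | mkℚ (+ n)    (suc d) c = refl
  ... | mkℚ -[1+ n ] d       c = refl

  shift-fromℤ : ∀ a f z → shift (fromℤ a) f (fromℤ z) ≡ ι f (z - a)
  shift-fromℤ a f z = shift-integral (fromℤ a) f (fromℤ z) (z - a) (fromℤ-minus z a)

  shift-fromℤ-fractional : ∀ a f e → (∀ z → e ≢ fromℤ z) → shift (fromℤ a) f e ≡ 0ℤ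
  shift-fromℤ-fractional a f e ne = shift-fractional (fromℤ a) f e λ y eq → ne (y + a)
    (trans (x e (fromℤ a)) (trans (cong (ℚ._+ fromℤ a) eq) (sym (fromℤ-+ y a))))
    where
    open Data.Rational.Solver.+-*-Solver
    x : ∀ p r → p ≡ p ℚ.- r ℚ.+ r
    x = solve 2 (λ p r → p := p :- r :+ r) refl

  T-4* : ∀ j → T (+ 4 * j) ≡ + 8 * (j * j) + + 2 * j
  T-4* j = T-unique (+ 4 * j) _ (x j)
    where
    x : ∀ j → (+ 8 * (j * j) + + 2 * j) + (+ 8 * (j * j) + + 2 * j) ≡ + 4 * j * (+ 4 * j + 1ℤ)
    x = solve-∀

  -- Here α + β = 21/4 and α - β = 5/4, so the exponent is j(21j + 5)/2 = 10j² + 2j + T(j). Keeping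
  -- the half-integral part inside T(j) makes integrality visible, and 8j² + 2j of the rest is
  -- T(4j).
  exponent-integral : ∀ j → exponent (+ 13 ℚ./ 4) (+ 2 ℚ./ 1) 4 j ≡ fromℤ (κ j + T (+ 4 * j))
  exponent-integral j = begin
    fromℤ (+ 4 * j) ℚ.* (((α ℚ.+ β) ℚ.* x ℚ.+ (α ℚ.- β)) ℚ.* ½)
      ≡⟨ cong (ℚ._* (((α ℚ.+ β) ℚ.* x ℚ.+ (α ℚ.- β)) ℚ.* ½)) (fromℤ-* (+ 4) j) ⟩
    (+ 4 ℚ./ 1) ℚ.* x ℚ.* (((α ℚ.+ β) ℚ.* x ℚ.+ (α ℚ.- β)) ℚ.* ½)
      ≡⟨ expand x ⟩
    ((+ 10 ℚ./ 1) ℚ.* (x ℚ.* x) ℚ.+ (+ 2 ℚ./ 1) ℚ.* x) ℚ.+ ½ ℚ.* (x ℚ.* (x ℚ.+ ℚ.1ℚ))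
      ≡⟨ cong₂ ℚ._+_ quadratic triangular ⟩
    fromℤ (+ 10 * (j * j) + + 2 * j) ℚ.+ fromℤ (T j)
      ≡⟨ fromℤ-+ (+ 10 * (j * j) + + 2 * j) (T j) ⟨
    fromℤ (+ 10 * (j * j) + + 2 * j + T j)
      ≡⟨ cong fromℤ (trans (collect j (T j)) (cong (λ y → κ j + y) (sym (T-4* j)))) ⟩
    fromℤ (κ j + T (+ 4 * j)) ∎
    where
    open ≡-Reasoning
    open Data.Rational.Solver.+-*-Solver
    α = + 13 ℚ./ 4
    β = + 2 ℚ./ 1
    x = fromℤ j
    collect : ∀ j t → + 10 * (j * j) + + 2 * j + t ≡ (j * j + j * j + t) + (+ 8 * (j * j) + + 2 * j)
    collect = solve-∀
    quadratic : (+ 10 ℚ./ 1) ℚ.* (x ℚ.* x) ℚ.+ (+ 2 ℚ./ 1) ℚ.* x ≡ fromℤ (+ 10 * (j * j) + + 2 * j)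
    quadratic = sym (trans (fromℤ-+ (+ 10 * (j * j)) (+ 2 * j)) (cong₂ ℚ._+_
      (trans (fromℤ-* (+ 10) (j * j)) (cong ((+ 10 ℚ./ 1) ℚ.*_) (fromℤ-* j j)))
      (fromℤ-* (+ 2) j)))
    halve : ∀ t → ½ ℚ.* (t ℚ.+ t) ≡ t
    halve = solve 1 (λ t → con ½ :* (t :+ t) := t) refl
    triangular : ½ ℚ.* (x ℚ.* (x ℚ.+ ℚ.1ℚ)) ≡ fromℤ (T j)
    triangular = trans
      (cong (½ ℚ.*_) (sym (trans (sym (fromℤ-+ (T j) (T j))) (trans (cong fromℤ (T-double j))
        (trans (fromℤ-* j (j + 1ℤ)) (cong (x ℚ.*_) (fromℤ-+ j 1ℤ)))))))
      (halve (fromℤ (T j)))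
    expand : ∀ x → (+ 4 ℚ./ 1) ℚ.* x ℚ.* (((α ℚ.+ β) ℚ.* x ℚ.+ (α ℚ.- β)) ℚ.* ½) ≡
      ((+ 10 ℚ./ 1) ℚ.* (x ℚ.* x) ℚ.+ (+ 2 ℚ./ 1) ℚ.* x) ℚ.+ ½ ℚ.* (x ℚ.* (x ℚ.+ ℚ.1ℚ))
    expand = solve 1 (λ x →
      con (+ 4 ℚ./ 1) :* x :* (((con α :+ con β) :* x :+ (con α :- con β)) :* con ½) :=
      (con (+ 10 ℚ./ 1) :* (x :* x) :+ con (+ 2 ℚ./ 1) :* x) :+ con ½ :* (x :* (x :+ con ℚ.1ℚ))) refl

  -- Coefficients of `G` at integral and fractional exponents

  n+[n+1]≡1+double : ∀ L → L ℕ.+ (L ℕ.+ 1) ≡ suc (double L)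
  n+[n+1]≡1+double L = ℤ.+-injective (trans (x (+ L)) (cong (λ d → 1ℤ + d) (sym (+-double L))))
    where
    x : ∀ n → n + (n + 1ℤ) ≡ 1ℤ + (n + n)
    x = solve-∀

  exponents : ℤ → ℚ
  exponents = exponent (+ 13 ℚ./ 4) (+ 2 ℚ./ 1) 4

  module _ (L : ℕ) where

    binomials : ℤ → Series
    binomials j = qBinomial (+ L + + (L ℕ.+ 1)) (+ L - + 4 * j)

    shift-binomials : ∀ z j → shift (exponents j) (binomials j) (fromℤ z) ≡ P L (+ 4 * j) (z - κ j)
    shift-binomials z j = begin
      shift (exponents j) (binomials j) (fromℤ z)
        ≡⟨ cong (λ s → shift s (binomials j) (fromℤ z)) (exponent-integral j) ⟩
      shift (fromℤ (κ j + T (+ 4 * j))) (binomials j) (fromℤ z)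
        ≡⟨ shift-fromℤ (κ j + T (+ 4 * j)) (binomials j) z ⟩
      ι (binomials j) (z - (κ j + T (+ 4 * j)))
        ≡⟨ ι-qBinomial (L ℕ.+ (L ℕ.+ 1)) (+ L - + 4 * j) _ ⟩
      gauss (L ℕ.+ (L ℕ.+ 1)) (+ L - + 4 * j) (z - (κ j + T (+ 4 * j)))
        ≡⟨ cong₂ (λ k → gauss k (+ L - + 4 * j)) (n+[n+1]≡1+double L) (x z (κ j) (T (+ 4 * j))) ⟩
      P L (+ 4 * j) (z - κ j) ∎
      where
      open ≡-Reasoning
      x : ∀ z a b → z - (a + b) ≡ z - a - b
      x = solve-∀

    cutoff = L ℕ.+ (L ℕ.+ 1)

    G-integral : ∀ z → G L (L ℕ.+ 1) (+ 13 ℚ./ 4) (+ 2 ℚ./ 1) 4 (fromℤ z) ≡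
      Σ± cutoff (λ i → sgn i * P L (+ 4 * i) (z - κ i))
    G-integral z = Σ±-cong cutoff λ j → cong (sgn j *_) (shift-binomials z j)

    G-fractional : ∀ e → (∀ z → e ≢ fromℤ z) → G L (L ℕ.+ 1) (+ 13 ℚ./ 4) (+ 2 ℚ./ 1) 4 e ≡ 0ℤ
    G-fractional e e∉ℤ = Σ±-zero cutoff λ j → trans (cong (sgn j *_)
      (trans (cong (λ s → shift s (binomials j) e) (exponent-integral j))
             (shift-fromℤ-fractional (κ j + T (+ 4 * j)) (binomials j) e e∉ℤ)))
      (ℤ.*-zeroʳ (sgn j))

  shift-0 : ∀ f z → shift 0ℚ f (fromℤ z) ≡ ι f z
  shift-0 f z = trans (shift-fromℤ 0ℤ f z) (cong (ι f) (ℤ.+-identityʳ z))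

open import Data.Nat.Base using (ℕ; _+_)
open import Data.Integer.Base using (+_)
open import Data.Rational.Base using (_/_)
open Positivity using (integer?; P-sum-NonNeg; G-integral; G-fractional; shift-0; shift-fromℤ-fractional)

mainTheorem12 : (L : ℕ) → G L (L + 1) (+ 13 / 4) (+ 2 / 1) 4 ≥0
-- Positivity is known for every window b > L, so b can be the cutoff built into `G`, and no two
-- truncations have to be compared.
mainTheorem12 L with cs , nonNeg ← P-sum-NonNeg L (L + (L + 1)) (ℕ.m<m+n L (ℕ.m≤n+m 1 L)) =
  cs , coefficient
  where
  coefficient : ∀ e → G L (L + 1) (+ 13 / 4) (+ 2 / 1) 4 e ≡ shift 0ℚ (polynomial cs) e
  coefficient e with integer? e
  ... | inj₁ (z , refl) =
    trans (G-integral L z) (trans (nonNeg z) (sym (shift-0 (polynomial cs) z)))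
  ... | inj₂ e∉ℤ =
    trans (G-fractional L e e∉ℤ) (sym (shift-fromℤ-fractional (+ 0) (polynomial cs) e e∉ℤ))
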